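{- $\alpha(W_5^{\Box 4}\Box K_3) \le 1019$.
   Context: All graphs are finite and simple. $W_{5}$ denotes the $5$-wheel, the join of the cycle $C_{5}$ with a single vertex $K_1$ (so $W_5$ has $6$ vertices). The Cartesian product $G \Box H$ has vertex set $V(G)\times V(H)$, with $(u,x)$ adjacent to $(v,y)$ if and only if either $u=v$ and $xy\in E(H)$, or $x=y$ and $uv\in E(G)$. Set $G^{\Box 1}=G$ and $G^{\Box k}=G^{\Box (k-1)}\Box G$ for $k\ge 2$. $\alpha(G)$ is the independence number of $G$, and $K_3$ is the complete graph on $3$ vertices. -}

module Defs where

open import Data.Nat.Base using (ℕ; zero; suc; _+_; _*_; _≤_; z≤n; NonZero)
open import Data.Nat.DivMod using (_%_)
open import Data.Nat.Properties using () renaming (_≟_ to _≟ℕ_)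
open import Data.Fin.Base using (Fin; toℕ)
open import Data.Fin.Properties using (all?; +↔⊎; *↔×) renaming (_≟_ to _≟ᶠ_)
open import Data.Fin.Subset using (Subset; inside; outside; _∈_; ∣_∣; ⊥)
open import Data.Fin.Subset.Properties using (_∈?_; ∉⊥; ∣⊥∣≡0)
open import Data.Vec.Base using ([]; _∷_)
open import Data.List.Base using (List; [_]; _++_; map; filter)
open import Data.List.Extrema.Nat using (max; xs≤max; argmax-sel)
import Data.List.Membership.Propositional as List
open import Data.List.Membership.Propositional.Properties
  using (∈-map⁺; ∈-map⁻; ∈-++⁺ˡ; ∈-++⁺ʳ; ∈-filter⁺; ∈-filter⁻)
open import Data.List.Relation.Unary.Any using (here)
import Data.List.Relation.Unary.All as All
open import Data.Product.Base using (_×_; _,_; proj₂; ∃-syntax)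
open import Data.Product.Function.NonDependent.Propositional using (_×-↔_)
open import Data.Sum.Base using (_⊎_; inj₁; inj₂; swap)
open import Data.Sum.Function.Propositional using (_⊎-↔_)
open import Data.Unit.Base using (⊤; tt)
open import Data.Empty using (⊥-elim)
open import Function.Base using (id)
open import Function.Bundles using (_↔_; Inverse)
open import Function.Construct.Identity using (↔-id)
open import Function.Construct.Composition using (_↔-∘_)
open import Function.Properties.Inverse using (↔-sym; ↔⇒↣)
open import Relation.Binary.Core using (Rel)
open import Relation.Binary.Definitions using (Symmetric; Decidable; DecidableEquality)
open import Relation.Binary.PropositionalEquality using (_≡_; _≢_; refl; sym; trans)
open import Relation.Nullary using (¬_; Dec; yes; ¬?; _×-dec_; _⊎-dec_; _→-dec_)
open import Relation.Nullary.Decidable using (via-injection; toWitness)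
open import Level using (0ℓ)

-- The enumeration serves only to make the vertex set finite and to let a set
-- of vertices be represented by the library's `Subset order`.
record Graph : Set₁ where
  infix 4 _~_ _~?_
  field
    V         : Set
    order     : ℕ
    enumerate : Fin order ↔ V
    _~_       : Rel V 0ℓ
    _~?_      : Decidable _~_
    ~-sym     : Symmetric _~_
    ~-irrefl  : ∀ {v} → ¬ (v ~ v)

  vertex : Fin order → V
  vertex = Inverse.to enumerate

  _≟_ : DecidableEquality V
  _≟_ = via-injection (↔⇒↣ (↔-sym enumerate)) _≟ᶠ_

  Independent : Subset order → Set
  Independent S = ∀ i j → i ∈ S → j ∈ S → ¬ (vertex i ~ vertex j)

  independent? : ∀ S → Dec (Independent S)
  independent? S = all? λ i → all? λ j →
    (i ∈? S) →-dec ((j ∈? S) →-dec ¬? (vertex i ~? vertex j))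

subsets : ∀ n → List (Subset n)
subsets zero    = [ [] ]
subsets (suc n) = map (inside ∷_) (subsets n) ++ map (outside ∷_) (subsets n)

-- The base value 0 of `max` is harmless: the empty set is independent.
α : Graph → ℕ
α G = max 0 (map ∣_∣ (filter independent? (subsets order)))
  where open Graph G

K : ℕ → Graph
K n = record
  { V = Fin n ; order = n ; enumerate = ↔-id (Fin n)
  ; _~_ = _≢_ ; _~?_ = λ i j → ¬? (i ≟ᶠ j)
  ; ~-sym = λ i≢j j≡i → i≢j (sym j≡i) ; ~-irrefl = λ i≢i → i≢i refl
  }

C₅ : Graph
C₅ = record
  { V = Fin 5 ; order = 5 ; enumerate = ↔-id (Fin 5)
  ; _~_ = _~_ ; _~?_ = _~?_ ; ~-sym = swap
  ; ~-irrefl = λ {v} → toWitness {a? = all? λ i → ¬? (i ~? i)} tt v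
  }
  where
  _~_ : Rel (Fin 5) 0ℓ
  i ~ j = suc (toℕ i) % 5 ≡ toℕ j ⊎ suc (toℕ j) % 5 ≡ toℕ i

  _~?_ : Decidable _~_
  i ~? j = (suc (toℕ i) % 5 ≟ℕ toℕ j) ⊎-dec (suc (toℕ j) % 5 ≟ℕ toℕ i)

infixl 6 _▽_
infixl 7 _□_
infixl 8 _^□_

-- G ▽ H is the join: the disjoint union with every vertex of G joined to every vertex of H.
_▽_ : Graph → Graph → Graph
G ▽ H = record
  { V = G.V ⊎ H.V ; order = G.order + H.order
  ; enumerate = (G.enumerate ⊎-↔ H.enumerate) ↔-∘ +↔⊎
  ; _~_ = _~_ ; _~?_ = _~?_
  ; ~-sym = λ {x} {y} → ~-sym x y ; ~-irrefl = λ {x} → ~-irrefl x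
  }
  where
  module G = Graph G
  module H = Graph H

  _~_ : Rel (G.V ⊎ H.V) 0ℓ
  inj₁ u ~ inj₁ v = u G.~ v
  inj₁ _ ~ inj₂ _ = ⊤
  inj₂ _ ~ inj₁ _ = ⊤
  inj₂ x ~ inj₂ y = x H.~ y

  _~?_ : Decidable _~_
  inj₁ u ~? inj₁ v = u G.~? v
  inj₁ _ ~? inj₂ _ = yes tt
  inj₂ _ ~? inj₁ _ = yes tt
  inj₂ x ~? inj₂ y = x H.~? y

  ~-sym : ∀ x y → x ~ y → y ~ x
  ~-sym (inj₁ _) (inj₁ _) = G.~-sym
  ~-sym (inj₁ _) (inj₂ _) = id
  ~-sym (inj₂ _) (inj₁ _) = id
  ~-sym (inj₂ _) (inj₂ _) = H.~-sym

  ~-irrefl : ∀ x → ¬ (x ~ x)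
  ~-irrefl (inj₁ _) = G.~-irrefl
  ~-irrefl (inj₂ _) = H.~-irrefl

_□_ : Graph → Graph → Graph
G □ H = record
  { V = G.V × H.V ; order = G.order * H.order
  ; enumerate = (G.enumerate ×-↔ H.enumerate) ↔-∘ *↔×
  ; _~_ = _~_ ; _~?_ = _~?_
  ; ~-sym = ~-sym ; ~-irrefl = ~-irrefl
  }
  where
  module G = Graph G
  module H = Graph H

  _~_ : Rel (G.V × H.V) 0ℓ
  (u , x) ~ (v , y) = (u ≡ v × x H.~ y) ⊎ (x ≡ y × u G.~ v)

  _~?_ : Decidable _~_
  (u , x) ~? (v , y) =
    ((u G.≟ v) ×-dec (x H.~? y)) ⊎-dec ((x H.≟ y) ×-dec (u G.~? v))

  ~-sym : Symmetric _~_
  ~-sym (inj₁ (u≡v , x~y)) = inj₁ (sym u≡v , H.~-sym x~y)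
  ~-sym (inj₂ (x≡y , u~v)) = inj₂ (sym x≡y , G.~-sym u~v)

  ~-irrefl : ∀ {p} → ¬ (p ~ p)
  ~-irrefl (inj₁ (_ , x~x)) = H.~-irrefl x~x
  ~-irrefl (inj₂ (_ , u~u)) = G.~-irrefl u~u

_^□_ : Graph → (k : ℕ) → .{{NonZero k}} → Graph
G ^□ suc zero    = G
G ^□ suc (suc k) = G ^□ suc k □ G

W₅ : Graph
W₅ = C₅ ▽ K 1

∈-subsets : ∀ {n} (S : Subset n) → S List.∈ subsets n
∈-subsets []            = here refl
∈-subsets (inside ∷ S)  = ∈-++⁺ˡ (∈-map⁺ (inside ∷_) (∈-subsets S))
∈-subsets (outside ∷ S) =
  ∈-++⁺ʳ (map (inside ∷_) (subsets _)) (∈-map⁺ (outside ∷_) (∈-subsets S))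

module _ (G : Graph) where
  open Graph G

  α-upper : ∀ S → Independent S → ∣ S ∣ ≤ α G
  α-upper S ind = All.lookup (xs≤max 0 (map ∣_∣ (filter independent? (subsets order))))
    (∈-map⁺ ∣_∣ (∈-filter⁺ independent? (∈-subsets S) ind))

  α-attained : ∃[ S ] (Independent S × ∣ S ∣ ≡ α G)
  α-attained with argmax-sel id 0 (map ∣_∣ (filter independent? (subsets order)))
  ... | inj₁ α≡0 = ⊥ , (λ i j i∈ _ → ⊥-elim (∉⊥ i∈)) , trans (∣⊥∣≡0 order) (sym α≡0)
  ... | inj₂ α∈ with ∈-map⁻ ∣_∣ α∈
  ...   | S , S∈ , α≡∣S∣ = S , proj₂ (∈-filter⁻ independent? {xs = subsets order} S∈) , sym α≡∣S∣

{-# OPTIONS --safe #-}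

-- An independent set of H □ K₃ is a partial 3-colouring of H, so the claim is
-- that every partial 3-colouring of W₅⁴ leaves at least 277 vertices uncoloured
-- (has 277 gaps).  For positions z, w in the last two factors let F(z,w) be the
-- number of gaps in the plane W₅ □ W₅ at (z,w).  Every plane has at least 7 gaps.
-- The crucial fact is about three factors: if the six planes of a coloured
-- W₅ □ W₅ □ W₅ have F(z) gaps, then ∑ F(z) + F(hub) ≥ 54.  Applied in each of the
-- last two directions, for the five rim positions of the other one, it gives
-- 2 ∑ F(z,w) ≥ 2 · 5 · 54 + 2 F(hub,hub) ≥ 554.
--
-- Suppose that ∑ F(z) + F(hub) ≤ 53.  If F(hub) = 7, then some two adjacent rim
-- planes have 7 and at most 8 gaps, otherwise some two adjacent rim planes have 7
-- each.  So two adjacent planes are tight (have 7 gaps), and symmetries reduce the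
-- first of them to 17 cases.  Now regard the configuration as six planes across the
-- tight ones, in each of which two lines are known.  The least numbers of gaps with
-- which these six planes can be completed add up to nearly the permitted total, so
-- that the search for the remaining lines, pruned by these bounds, is short enough
-- to be done by evaluation.

module Submission where

open import Defs

open import Data.Bool.Base using (Bool; true; false; _∧_; if_then_else_; T)
open import Data.Bool.ListAction using (all)
import Data.Bool.Properties as Bool
open import Data.Empty using (⊥; ⊥-elim)
open import Data.Fin.Base using (Fin; zero; suc; combine; remQuot; _↑ˡ_; _↑ʳ_)
open import Data.Fin.Patterns using (0F; 1F; 2F; 3F; 4F; 5F)
open import Data.Fin.Properties using (remQuot-combine) renaming (all? to allFin?)
open import Data.Fin.Subset using (Subset; inside; outside; ∣_∣)
open import Data.List.Base using (List; []; _∷_; _++_; map; concatMap; filterᵇ; null)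
open import Data.List.Membership.Propositional using (_∈_)
open import Data.List.Membership.Propositional.Properties using (∈-map⁺; ∈-concatMap⁺; ∈-filter⁺)
open import Data.List.Relation.Unary.All as All using (all?)
open import Data.List.Relation.Unary.Any as Any using (Any; here; there; any?)
open import Data.List.Relation.Unary.Any.Properties using (map⁺)
open import Data.Nat.Base
open import Data.Nat.Properties
open import Algebra.Properties.CommutativeSemigroup +-commutativeSemigroup using (interchange)
open import Data.Nat.Tactic.RingSolver using (solve-∀)
open import Data.Product.Base as Product using (_×_; _,_; proj₁; proj₂; ∃-syntax; uncurry)
open import Data.Sum.Base using (inj₁; inj₂)
open import Data.Unit.Base using (⊤; tt)
open import Data.Vec.Base as Vec using (Vec; []; _∷_; lookup)
import Data.Vec.Membership.Propositional as Vec
open import Data.Vec.Properties using (lookup⇒[]=)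
open import Data.Vec.Relation.Unary.Any using (here; there)
open import Function.Base using (id; _∘_)
open import Function.Bundles using (Equivalence)
open import Relation.Binary.Definitions using (DecidableEquality)
open import Relation.Binary.PropositionalEquality
  using (_≡_; _≢_; refl; sym; trans; cong; cong₂; subst)
open import Relation.Nullary using (¬_; Dec; yes; no; does; _because_; invert; _×-dec_; _→-dec_; T?)
open import Relation.Nullary.Decidable using (map′; toWitness)

-- The search

data Colour : Set where
  none red green blue : Colour

-- The colours of a copy of W₅: the rim in cyclic order, then the hub.
data Line : Set where
  line : (r₀ r₁ r₂ r₃ r₄ h : Colour) → Line

agree : Colour → Colour → Bool
agree none  _     = true
agree red   red   = false
agree red   _     = true
agree green green = false
agree green _     = true
agree blue  blue  = false
agree blue  _     = true

compat : Line → Line → Bool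
compat (line a₀ a₁ a₂ a₃ a₄ h) (line b₀ b₁ b₂ b₃ b₄ k) =
  agree a₀ b₀ ∧ agree a₁ b₁ ∧ agree a₂ b₂ ∧ agree a₃ b₃ ∧ agree a₄ b₄ ∧ agree h k

proper : Line → Bool
proper (line a₀ a₁ a₂ a₃ a₄ h) =
  agree a₀ a₁ ∧ agree a₁ a₂ ∧ agree a₂ a₃ ∧ agree a₃ a₄ ∧ agree a₄ a₀ ∧
  agree h a₀ ∧ agree h a₁ ∧ agree h a₂ ∧ agree h a₃ ∧ agree h a₄

gap : Colour → ℕ
gap none = 1
gap _    = 0

-- Summed in the sequence of `order`, so that `cost (mk f)` is `∑ (gap ∘ f)` by definition.
cost : Line → ℕ
cost (line a₀ a₁ a₂ a₃ a₄ h) =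
  gap h + (gap a₀ + (gap a₁ + (gap a₄ + (gap a₂ + (gap a₃ + 0)))))

colours : List Colour
colours = none ∷ red ∷ green ∷ blue ∷ []

allLines : List Line
allLines = concatMap (λ a₀ → concatMap (λ a₁ → concatMap (λ a₂ → concatMap (λ a₃ →
  concatMap (λ a₄ → map (line a₀ a₁ a₂ a₃ a₄) colours) colours) colours) colours) colours) colours

-- Items in boxes, each box with a numeric label.
Shelf : Set → Set
Shelf A = List (ℕ × List A)

linesOfCost : ℕ → List Line
linesOfCost k = filterᵇ (λ l → proper l ∧ (cost l ≡ᵇ k)) allLines

-- Boxes are labelled by the cost of their lines.
lineShelf : Shelf Line
lineShelf = map (λ k → k , linesOfCost k) (1 ∷ 2 ∷ 3 ∷ 4 ∷ 5 ∷ 6 ∷ [])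

-- A possible line in some position, a lower bound for what it costs there, and
-- the data from which the search continues in that position.
record Choice (P : Set) : Set where
  constructor choice
  field
    ln   : Line
    own  : ℕ
    rest : P
open Choice

-- The label of a box, and lb for the whole menu, bound from below the cost of
-- a choice together with everything that is still to come after it.
record Menu (P : Set) : Set where
  constructor menu
  field
    lb    : ℕ
    items : Shelf (Choice P)
open Menu

-- Above every budget of the search: as the bound of an empty menu it cuts the branch off, and as a
-- cap on an excess it stands for no restriction.
∞ : ℕ
∞ = 1000

min : ℕ → ℕ → ℕ
min m n = if m <ᵇ n then m else n

least : ∀ {A} → Shelf A → ℕ
least []             = ∞
least ((v , _) ∷ sh) = min v (least sh)

mkMenu : ∀ {P} → Shelf (Choice P) → Menu P
mkMenu sh = menu (least sh) sh

insert : ∀ {A : Set} → ℕ → A → Shelf A → Shelf A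
insert t x []               = (t , x ∷ []) ∷ []
insert t x ((v , xs) ∷ sh) =
  if t ≡ᵇ v then (v , x ∷ xs) ∷ sh else (v , xs) ∷ insert t x sh

-- Empty boxes are dropped because `least` looks at labels only, and `graft` takes a shelf with a
-- box to offer something.
box : ∀ {A : Set} → ℕ → List A → Shelf A → Shelf A
box v []          sh = sh
box v xs@(_ ∷ _) sh = (v , xs) ∷ sh

choose : ∀ {A : Set} → (A → Line) → Line → List A → List A
choose f l []       = []
choose f l (x ∷ xs) = if compat l (f x) then x ∷ choose f l xs else choose f l xs

within : ∀ {A : Set} → (A → Line) → ℕ → Line → Shelf A → Shelf A
within f k l []              = []
within f k l ((v , xs) ∷ sh) =
  if v ≤ᵇ k then box v (choose f l xs) (within f k l sh) else within f k l sh

-- For each position a mask telling which of the later positions are adjacent to it.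
Masks : ℕ → Set
Masks zero    = ⊤
Masks (suc n) = Vec Bool n × Masks n

-- W₅ in the order hub, 0, 1, 4, 2, 3.
wheel : Masks 6
wheel = (true ∷ true ∷ true ∷ true ∷ true ∷ []) , (true ∷ true ∷ false ∷ false ∷ []) ,
        (false ∷ true ∷ false ∷ []) , (false ∷ true ∷ []) , (true ∷ []) , [] , tt

lbs : ∀ {P n} → Vec (Menu P) n → ℕ
lbs []       = 0
lbs (m ∷ ms) = lb m + lbs ms

-- Here `room` is what the limit leaves above the sum of all lower bounds. The other positions take
-- at least their bounds, so a single one exceeds its own by at most `room`.
narrow : ∀ {P n} → Line → ℕ → Vec Bool n → Vec (Menu P) n → Vec (Menu P) n
narrow l room []           []       = []
narrow l room (false ∷ fs) (m ∷ ms) = m ∷ narrow l room fs ms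
narrow l room (true ∷ fs)  (m ∷ ms) =
  mkMenu (within ln (lb m + room) l (items m)) ∷ narrow l room fs ms

module _ {P : Set} where

  -- refute φ ms lim bud exc k chooses from each menu, compatibly along φ; the
  -- result true means that k refutes all possible choices.  Here lim bounds
  -- the total of the labels, bud the total cost, of which k receives what the
  -- choices leave over, and exc the sum of all own ∸ 1.
  refute : ∀ {n} → Masks n → Vec (Menu P) n → (lim bud exc : ℕ) → (Vec P n → ℕ → Bool) → Bool
  tryShelf : ∀ {n} → Vec Bool n → Masks n → Shelf (Choice P) → Vec (Menu P) n →
             (others lim bud exc : ℕ) → (Vec P (suc n) → ℕ → Bool) → Bool
  tryBox : ∀ {n} → Vec Bool n → Masks n → ℕ → List (Choice P) → Vec (Menu P) n →
           (room lim bud exc : ℕ) → (Vec P (suc n) → ℕ → Bool) → Bool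
  enter : ∀ {n} → Masks n → ℕ → Choice P → Vec (Menu P) n →
          (lim bud exc : ℕ) → (Vec P (suc n) → ℕ → Bool) → Bool

  refute {zero}  _             []       lim bud exc k = k [] bud
  refute {suc n} (mask , φ) (m ∷ ms) lim bud exc k =
    tryShelf mask φ (items m) ms (lbs ms) lim bud exc k

  tryShelf mask φ []              ms others lim bud exc k = true
  tryShelf mask φ ((v , cs) ∷ sh) ms others lim bud exc k =
    (if v + others ≤ᵇ lim
     then tryBox mask φ v cs ms (lim ∸ (v + others)) lim bud exc k
     else true) ∧
    tryShelf mask φ sh ms others lim bud exc k

  tryBox mask φ v []       ms room lim bud exc k = true
  tryBox mask φ v (c ∷ cs) ms room lim bud exc k =
    (if pred (own c) ≤ᵇ exc
     then enter φ v c (narrow (ln c) room mask ms) lim bud exc k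
     else true) ∧
    tryBox mask φ v cs ms room lim bud exc k

  enter φ v c ms lim bud exc k =
    if v + lbs ms ≤ᵇ lim
    then refute φ ms (lim ∸ v) (bud ∸ own c) (exc ∸ pred (own c)) (λ ps → k (rest c ∷ ps))
    else true

-- Paths of lines across the planes

Tree : ℕ → Set
Tree zero    = ⊤
Tree (suc n) = Menu (Tree n)

-- Proceeds plane by plane: the six paths take their next lines together, compatibly along the
-- wheel, and `exc` caps the excess of that plane. Reaching the end means that a configuration has
-- survived, hence `false`.
refuteTrees : ∀ n → Vec (Tree n) 6 → ℕ → Vec ℕ n → Bool
refuteTrees zero    ts bud []         = false
refuteTrees (suc n) ts bud (exc ∷ es) =
  refute wheel ts bud bud exc (λ us bud′ → refuteTrees n us bud′ es)

near : ∀ {A : Set} → (A → Line) → Line → Shelf A → Shelf A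
near f l []              = []
near f l ((v , xs) ∷ sh) = (v , choose f l xs) ∷ near f l sh

upTo : ∀ {A : Set} → ℕ → Shelf A → Shelf A
upTo k []              = []
upTo k ((v , xs) ∷ sh) = if v ≤ᵇ k then (v , xs) ∷ upTo k sh else upTo k sh

graft : ∀ {P} → Line → ℕ → Shelf (Choice P) → Shelf (Choice (Menu P)) → Shelf (Choice (Menu P))
graft l v []          acc = acc
-- Passing the menu to `add` lets the label and the choice share its evaluation.
graft l v sh@(_ ∷ _) acc = add (mkMenu sh)
  where
  add : Menu _ → Shelf (Choice (Menu _))
  add m = insert (v + lb m) (choice l v m) acc

extendBox : ∀ {P} → ℕ → ℕ → List Line → Shelf (Choice P) →
            Shelf (Choice (Menu P)) → Shelf (Choice (Menu P))
extendBox k v []       sh acc = acc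
extendBox k v (l ∷ ls) sh acc = graft l v (within ln k l sh) (extendBox k v ls sh acc)

extend : ∀ {P} → ℕ → Shelf Line → Shelf (Choice P) → Shelf (Choice (Menu P))
extend bud []              sh = []
extend bud ((v , ls) ∷ cs) sh = extendBox (bud ∸ v) v ls sh (extend bud cs sh)

options : ∀ {A P : Set} → (A → Line) → (A → P) → Shelf A → Shelf (Choice P)
options f g []              = []
options f g ((v , xs) ∷ sh) = (v , map (λ x → choice (f x) v (g x)) xs) ∷ options f g sh

-- Sequences of suc n lines from sh, of total cost at most bud, whose last line is compatible with e.
tails : ∀ n → ℕ → Line → Shelf Line → Shelf (Choice (Tree n))
tails zero    bud e sh = options id (λ _ → tt) (near id e sh)
-- The line in front costs at least 1.
tails (suc n) bud e sh = extend bud sh (tails n (bud ∸ 1) e sh)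

pathTree : ∀ n → Shelf Line → (s e : Line) → ℕ → Tree (suc (suc n))
-- Each of the other `suc n` lines costs at least 1, which leaves `bud ∸ suc n` for a single line.
pathTree n nbs s e bud = build (upTo (bud ∸ suc n) nbs)
  where
  build : Shelf Line → Tree (suc (suc n))
  build sh = mkMenu (extend bud (near id s sh) (tails n (bud ∸ 1) e sh))

-- A lower bound for the cost of a path, and the trees for this budget and the next three.
record Paths (n : ℕ) : Set where
  constructor paths
  field
    shortest : ℕ
    forest   : Vec (Tree n) 4
open Paths

-- The budget is raised as long as no path is affordable. Should the fuel run out, the value reached
-- is still a lower bound.
search : ∀ n → Shelf Line → (s e : Line) → (fuel bud : ℕ) → ℕ
search n nbs s e zero       bud = bud
search n nbs s e (suc fuel) bud =
  if null (items (pathTree n nbs s e bud)) then search n nbs s e fuel (suc bud) else bud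

mkPaths : ∀ n → Shelf Line → (s e : Line) → (fuel : ℕ) → Paths (suc (suc n))
-- The search starts with one gap for each line of the path.
mkPaths n nbs s e fuel = build (search n nbs s e fuel (suc (suc n)))
  where
  build : ℕ → Paths (suc (suc n))
  build k = paths k (t k ∷ t (1 + k) ∷ t (2 + k) ∷ t (3 + k) ∷ [])
    where t = pathTree n nbs s e

shortests : ∀ {n m} → Vec (Paths n) m → ℕ
shortests []       = 0
shortests (p ∷ ps) = shortest p + shortests ps

select : ∀ {n} → ℕ → Paths n → Tree n
select 0 (paths _ (t ∷ _))             = t
select 1 (paths _ (_ ∷ t ∷ _))         = t
select 2 (paths _ (_ ∷ _ ∷ t ∷ _))     = t
select _ (paths _ (_ ∷ _ ∷ _ ∷ t ∷ _)) = t

-- If the budget exceeds the sum of the six bounds by `s`, no path exceeds its own bound by more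
-- than `s`, so the trees with that much slack suffice. Trees are kept for slack below 4; anything
-- larger counts as not refuted.
refutePaths : ∀ n → Vec ℕ n → Vec (Paths n) 6 → ℕ → Bool
refutePaths n es ps bud = if bud <ᵇ shortests ps then true else spare (bud ∸ shortests ps)
  where
  spare : ℕ → Bool
  spare s = (s <ᵇ 4) ∧ refuteTrees n (Vec.map (select s) ps) bud es

-- The neighbourhood is stored with the line so that it is evaluated only once.
record Node : Set where
  constructor node
  field
    at  : Line
    nbs : Shelf Line
open Node

nodes : (Line → Shelf Line) → Shelf Line → Shelf Node
nodes f []              = []
nodes f ((v , ls) ∷ sh) = (v , map (λ l → node l (f l)) ls) ∷ nodes f sh

lines : Shelf Node → Shelf Line
lines []              = []
lines ((v , ns) ∷ sh) = (v , map at ns) ∷ lines sh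

-- Lines h above a and b, for paths that lead from b to a inside the neighbourhood of h.
module Hubs (a b : Line) where

  -- How far the shortest path is searched for, by the cost of h; found by experiment.
  fuelFor : ℕ → ℕ
  fuelFor 1 = 3
  fuelFor 2 = 1
  fuelFor _ = 0

  add : Line → ℕ → Paths 3 → Shelf (Choice (Paths 3)) → Shelf (Choice (Paths 3))
  add h v p acc = insert (2 * v + shortest p) (choice h (2 * v) p) acc

  addBox : ℕ → List Node → Shelf (Choice (Paths 3)) → Shelf (Choice (Paths 3))
  addBox v []       acc = acc
  addBox v (h ∷ hs) acc = add (at h) v (mkPaths 1 (nbs h) b a (fuelFor v)) (addBox v hs acc)

  hubs : Shelf Node → Shelf (Choice (Paths 3))
  hubs []              = []
  hubs ((v , hs) ∷ sh) = addBox v hs (hubs sh)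

  hubMenu : Shelf Node → Menu (Paths 3)
  -- The hub plane is going to have at most 9 gaps, 3 more than its six lines must have, so each of
  -- its lines has at most 4.
  hubMenu ns = mkMenu (hubs (near at b (upTo 4 ns)))

Pair : Set
Pair = Paths 4 × Menu (Paths 3)

-- The same tight lines `a` and `b` serve both cases. If `a` is in the hub plane, four lines near
-- `a` lead round the rim from `b` back to `b`. If both are in rim planes, a hub line is chosen, and
-- three lines near it lead from `b` to `a`.
pair : Line → Shelf Line → Shelf Node → Line → Pair
pair a ls ns b = mkPaths 2 ls b b 4 , Hubs.hubMenu a b ns

record First : Set where
  constructor first
  field
    front   : Line
    seconds : Menu Pair
open First

mkFirst : Shelf Node → Line → First
mkFirst ns a = withNear (near at a ns)
  where
  withLines : Shelf Node → Shelf Line → First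
  -- A tight plane has 7 gaps on six lines with at least one each, so no line has more than 2.
  withLines ns′ ls = first a (mkMenu (options id (pair a ls ns′) (upTo 2 ls)))
  withNear : Shelf Node → First
  withNear ns′ = withLines ns′ (lines ns′)

-- One representative for each class of lines of cost at most 2 under the
-- symmetries of W₅ and the permutations of the colours.
rowReps : Shelf Line
rowReps =
  (1 , line blue green blue green red none ∷ line blue green blue green none red ∷ []) ∷
  (2 , line blue green none blue none red ∷ line blue green blue red none none ∷
       line blue green red blue none none ∷ line blue green blue none none red ∷
       line blue green blue green none none ∷ []) ∷ []

code : Line → ℕ
code (line a₀ a₁ a₂ a₃ a₄ _) = digit a₀ + 4 * (digit a₁ + 4 * (digit a₂ + 4 * (digit a₃ + 4 * digit a₄)))
  where
  digit : Colour → ℕ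
  digit none  = 0
  digit red   = 1
  digit green = 2
  digit blue  = 3

turn flip : Line → Line
turn (line a₀ a₁ a₂ a₃ a₄ h) = line a₁ a₂ a₃ a₄ a₀ h
flip (line a₀ a₁ a₂ a₃ a₄ h) = line a₀ a₄ a₃ a₂ a₁ h

images : Line → List Line
images l = turns l (turns (flip l) [])
  where
  turns : Line → List Line → List Line
  turns l ls = l ∷ turn l ∷ turn (turn l) ∷ turn (turn (turn l)) ∷ turn (turn (turn (turn l))) ∷ ls

-- Singles out the largest `code` among the ten images under rotations and reflections. These fix
-- the hub, whose colour is therefore left out of `code`.
canonical : Line → Bool
canonical l = all (λ l′ → code l′ ≤ᵇ code l) (images l)

hubOf : Line → Colour
hubOf (line _ _ _ _ _ h) = h

-- The colours at the hub of the second direction, read along the first. Symmetries of the first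
-- direction rearrange this column but keep the line at its hub, which has already been normalised.
column : Vec First 6 → Line
column (f₅ ∷ f₀ ∷ f₁ ∷ f₄ ∷ f₂ ∷ f₃ ∷ []) =
  line (hubOf (front f₀)) (hubOf (front f₁)) (hubOf (front f₂)) (hubOf (front f₃)) (hubOf (front f₄)) (hubOf (front f₅))

-- The first tight plane is the hub and the second is 0.  The total is at most
-- 46 = 2 · 7 + 32, and plane 1 has at most 8 = 6 + 2 gaps.
refuteHub : Vec Pair 6 → Bool
refuteHub v = refutePaths 4 (2 ∷ ∞ ∷ ∞ ∷ ∞ ∷ []) (Vec.map proj₁ v) 32

-- The tight planes are 0 and 1.  The total, with the hub counted twice, is at most
-- 53 = 2 · 7 + 39, and twice the gaps of the hub plane are at most 18 = 6 + 12.
refuteRim : Vec Pair 6 → Bool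
refuteRim v = refute wheel (Vec.map proj₂ v) 39 39 12 (λ ps bud → refutePaths 3 (∞ ∷ ∞ ∷ ∞ ∷ []) ps bud)

refuteFirsts : Vec First 6 → Bool
refuteFirsts v =
  if canonical (column v)
  then refute wheel (Vec.map seconds v) 7 7 1 (λ w _ → refuteHub w ∧ refuteRim w)
  else true

refuteNodes : Shelf Line → Shelf Node → Bool
refuteNodes reps ns = start (mkMenu (options id (mkFirst ns) (upTo 2 (lines ns))))
  where
  start : Menu First → Bool
  start m = refute wheel (mkMenu (options id (mkFirst ns) reps) ∷ m ∷ m ∷ m ∷ m ∷ m ∷ [])
              -- Tightness: 7 gaps in all, 1 more than the six lines must have.
              7 7 1 (λ v _ → refuteFirsts v)

-- Naming the shelf of nodes makes the evaluator share it, with all that has been computed in it.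
refuteCube : Shelf Line → Shelf Line → Bool
refuteCube reps sh = refuteNodes reps (nodes (λ l → near id l sh) sh)

refutePlane : Shelf Line → Bool
refutePlane sh = start (mkMenu (options id (λ _ → tt) sh))
  where
  start : Menu ⊤ → Bool
  start m = refute wheel (m ∷ m ∷ m ∷ m ∷ m ∷ m ∷ []) 6 6 ∞ (λ _ _ → false)

-- Soundness of the search

T⇒≡ : ∀ {b} → T b → b ≡ true
T⇒≡ = Equivalence.to Bool.T-≡

≤⇒true : ∀ {m n} → m ≤ n → (m ≤ᵇ n) ≡ true
≤⇒true m≤n = T⇒≡ (≤⇒≤ᵇ m≤n)

<⇒true : ∀ {m n} → m < n → (m <ᵇ n) ≡ true
<⇒true m<n = T⇒≡ (<⇒<ᵇ m<n)

∧⁻ : ∀ a {b} → a ∧ b ≡ true → a ≡ true × b ≡ true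
∧⁻ true b≡true = refl , b≡true

then⁻ : ∀ {b c} → b ≡ true → (if b then c else true) ≡ true → c ≡ true
then⁻ refl c≡true = c≡true

min≤ˡ : ∀ m n → min m n ≤ m
min≤ˡ m n with m <ᵇ n in eq
... | true  = ≤-refl
... | false = ≮⇒≥ λ m<n → case (trans (sym eq) (<⇒true m<n))
  where
  case : false ≡ true → ⊥
  case ()

min≤ʳ : ∀ m n → min m n ≤ n
min≤ʳ m n with m <ᵇ n in eq
... | true  = <⇒≤ (<ᵇ⇒< m n (Equivalence.from Bool.T-≡ eq))
... | false = ≤-refl

-- What happens in one position of a configuration that is to be refuted.
record Actual (P : Set) : Set₁ where
  field
    there-is     : Line
    spent later  : ℕ
    Good         : P → Set
  total : ℕ
  total = spent + later
open Actual

Matches : ∀ {P} → Actual P → Choice P → Set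
Matches a c = ln c ≡ there-is a × own c ≤ spent a × Good a (rest c)

Below : {A : Set} → ℕ → (A → Set) → Shelf A → Set
Below t Q = Any (λ (v , xs) → v ≤ t × Any Q xs)

Offers : ∀ {P} → Shelf (Choice P) → Actual P → Set
Offers sh a = Below (total a) (Matches a) sh

-- The invariant of the search: what is actually there has not been cut from the menu, and the bound
-- of the menu is true for it.
record _∋_ {P} (m : Menu P) (a : Actual P) : Set where
  constructor serves
  field
    bound : lb m ≤ total a
    offer : Offers (items m) a
open _∋_

least≤ : ∀ {A t} {Q : A → Set} {sh} → Below t Q sh → least sh ≤ t
least≤ {sh = (v , _) ∷ sh} (here (v≤t , _)) = ≤-trans (min≤ˡ v (least sh)) v≤t
least≤ {sh = (v , _) ∷ sh} (there q)        = ≤-trans (min≤ʳ v (least sh)) (least≤ q)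

mkMenu-∋ : ∀ {P} {sh} {a : Actual P} → Offers sh a → mkMenu sh ∋ a
mkMenu-∋ o = serves (least≤ o) o

module _ {A : Set} {Q : A → Set} where

  insert⁺ : ∀ {t u x} sh → u ≤ t → Q x → Below t Q (insert u x sh)
  insert⁺ []                     u≤t q = here (u≤t , here q)
  insert⁺ {u = u} ((v , _) ∷ sh) u≤t q with u ≡ᵇ v in eq
  ... | true  = here (subst (_≤ _) (≡ᵇ⇒≡ u v (Equivalence.from Bool.T-≡ eq)) u≤t , here q)
  ... | false = there (insert⁺ sh u≤t q)

  insert-there : ∀ {t u x} {sh} → Below t Q sh → Below t Q (insert u x sh)
  insert-there {u = u} {sh = (v , _) ∷ sh} (here (v≤t , q)) with u ≡ᵇ v
  ... | true  = here (v≤t , there q)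
  ... | false = here (v≤t , q)
  insert-there {u = u} {sh = (v , _) ∷ sh} (there b) with u ≡ᵇ v
  ... | true  = there b
  ... | false = there (insert-there b)

  box⁺ : ∀ {t v xs sh} → v ≤ t → Any Q xs → Below t Q (box v xs sh)
  box⁺ {xs = _ ∷ _} v≤t q = here (v≤t , q)

  box-there : ∀ {t v xs sh} → Below t Q sh → Below t Q (box v xs sh)
  box-there {xs = []}    b = b
  box-there {xs = _ ∷ _} b = there b

  module _ {f : A → Line} {l : Line} (ok : ∀ {x} → Q x → compat l (f x) ≡ true) where

    choose⁺ : ∀ {xs} → Any Q xs → Any Q (choose f l xs)
    choose⁺ {x ∷ _} (here q) with compat l (f x) | ok q
    ... | true | _ = here q
    choose⁺ {x ∷ _} (there q) with compat l (f x)
    ... | true  = there (choose⁺ q)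
    ... | false = choose⁺ q

    within⁺ : ∀ {t k sh} → t ≤ k → Below t Q sh → Below t Q (within f k l sh)
    within⁺ {k = k} {(v , _) ∷ _} t≤k (here (v≤t , q))
      with v ≤ᵇ k | ≤⇒true (≤-trans v≤t t≤k)
    ... | true | _ = box⁺ v≤t (choose⁺ q)
    within⁺ {k = k} {(v , xs) ∷ _} t≤k (there b) with v ≤ᵇ k
    ... | true  = box-there {xs = choose f l xs} (within⁺ t≤k b)
    ... | false = within⁺ t≤k b

Shelved : {A : Set} → ℕ → (A → Set) → Shelf A → Set
Shelved v Q = Any (λ (w , xs) → w ≡ v × Any Q xs)

module _ {A : Set} {v : ℕ} {Q : A → Set} where

  near⁺ : ∀ {f l sh} → (∀ {x} → Q x → compat l (f x) ≡ true) → Shelved v Q sh → Shelved v Q (near f l sh)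
  near⁺ ok (here (w≡v , q)) = here (w≡v , choose⁺ ok q)
  near⁺ ok (there s)        = there (near⁺ ok s)

  upTo⁺ : ∀ {k sh} → v ≤ k → Shelved v Q sh → Shelved v Q (upTo k sh)
  upTo⁺ {k} {(w , _) ∷ _} v≤k (here (refl , q)) with w ≤ᵇ k | ≤⇒true v≤k
  ... | true | _ = here (refl , q)
  upTo⁺ {k} {(w , _) ∷ _} v≤k (there s) with w ≤ᵇ k
  ... | true  = there (upTo⁺ v≤k s)
  ... | false = upTo⁺ v≤k s

  options⁺ : ∀ {P} {f : A → Line} {g : A → P} {a : Actual P} {sh} → v ≤ total a →
             (∀ {x} → Q x → Matches a (choice (f x) v (g x))) → Shelved v Q sh → Offers (options f g sh) a
  options⁺ v≤t m (here (refl , q)) = here (v≤t , map⁺ (Any.map m q))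
  options⁺ v≤t m (there s)         = there (options⁺ v≤t m s)

Serves : ∀ {P n} → Vec (Menu P) n → Vec (Actual P) n → Set
Serves []       []       = ⊤
Serves (m ∷ ms) (a ∷ as) = m ∋ a × Serves ms as

Goods : ∀ {P n} → Vec (Actual P) n → Vec P n → Set
Goods []       []       = ⊤
Goods (a ∷ as) (p ∷ ps) = Good a p × Goods as ps

Along : ∀ {P n} → Line → Vec Bool n → Vec (Actual P) n → Set
Along l []       []       = ⊤
Along l (f ∷ fs) (a ∷ as) = (f ≡ true → compat l (there-is a) ≡ true) × Along l fs as

Fits : ∀ {P n} → Masks n → Vec (Actual P) n → Set
Fits _          []       = ⊤
Fits (mask , φ) (a ∷ as) = Along (there-is a) mask as × Fits φ as

spents laters totals excesses : ∀ {P n} → Vec (Actual P) n → ℕ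
spents []         = 0
spents (a ∷ as)   = spent a + spents as
laters []         = 0
laters (a ∷ as)   = later a + laters as
totals []         = 0
totals (a ∷ as)   = total a + totals as
excesses []       = 0
excesses (a ∷ as) = pred (spent a) + excesses as

lbs≤totals : ∀ {P n} (ms : Vec (Menu P) n) as → Serves ms as → lbs ms ≤ totals as
lbs≤totals []       []       _       = z≤n
lbs≤totals (m ∷ ms) (a ∷ as) (s , r) = +-mono-≤ (bound s) (lbs≤totals ms as r)

share : ∀ {m n x y} r → m ≤ x → n ≤ y → x + y ≤ (m + n) + r → x ≤ m + r × y ≤ n + r
share {m} {n} {x} {y} r m≤x n≤y le = left , right
  where
  open ≤-Reasoning
  left : x ≤ m + r
  left = +-cancelʳ-≤ n x (m + r) (begin
    x + n         ≤⟨ +-monoʳ-≤ x n≤y ⟩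
    x + y         ≤⟨ le ⟩
    m + n + r     ≡⟨ +-assoc m n r ⟩
    m + (n + r)   ≡⟨ cong (m +_) (+-comm n r) ⟩
    m + (r + n)   ≡⟨ +-assoc m r n ⟨
    m + r + n     ∎)
  right : y ≤ n + r
  right = +-cancelˡ-≤ m y (n + r) (begin
    m + y         ≤⟨ +-monoˡ-≤ y m≤x ⟩
    x + y         ≤⟨ le ⟩
    m + n + r     ≡⟨ +-assoc m n r ⟩
    m + (n + r)   ∎)

narrow-serves : ∀ {P n} l room (fs : Vec Bool n) (ms : Vec (Menu P) n) as → Serves ms as →
                Along l fs as → totals as ≤ lbs ms + room → Serves (narrow l room fs ms) as
narrow-serves l room []       []       []       _       _        _  = tt
narrow-serves l room (f ∷ fs) (m ∷ ms) (a ∷ as) (s , r) (c , al) le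
  with share room (bound s) (lbs≤totals ms as r) le
narrow-serves l room (false ∷ fs) (m ∷ ms) (a ∷ as) (s , r) (c , al) le | _ , le₂ =
  s , narrow-serves l room fs ms as r al le₂
narrow-serves l room (true ∷ fs)  (m ∷ ms) (a ∷ as) (s , r) (c , al) le | le₁ , le₂ =
  mkMenu-∋ (within⁺ (λ { (refl , _) → c refl }) le₁ (offer s)) ,
  narrow-serves l room fs ms as r al le₂

∸-mono-+ : ∀ {v w x lim} → v ≤ w → w + x ≤ lim → x ≤ lim ∸ v
∸-mono-+ {v} {w} {x} {lim} v≤w le =
  m+n≤o⇒n≤o∸m v (≤-trans (+-monoˡ-≤ x v≤w) le)
  where
  m+n≤o⇒n≤o∸m : ∀ m {n o} → m + n ≤ o → n ≤ o ∸ m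
  m+n≤o⇒n≤o∸m m {n} {o} h = m+n≤o⇒m≤o∸n n (subst (_≤ o) (+-comm m n) h)

-- The actual configuration is one of the branches: each menu holds a choice matching it, and no cut
-- removes that choice. Hence `k` has been evaluated on its data, with at least the amount `L`
-- reserved for later still available.
refute-sound : ∀ {P n} (φ : Masks n) (ms : Vec (Menu P) n) {lim bud exc k} L (as : Vec (Actual P) n) →
  refute φ ms lim bud exc k ≡ true → Serves ms as → Fits φ as →
  totals as ≤ lim → spents as + L ≤ bud → excesses as ≤ exc →
  ∃[ ps ] ∃[ b ] (k ps b ≡ true × Goods as ps × L ≤ b)

tryShelf-sound : ∀ {P n} (mask : Vec Bool n) (φ : Masks n) sh (ms : Vec (Menu P) n) {lim bud exc k} L a as →
  tryShelf mask φ sh ms (lbs ms) lim bud exc k ≡ true → Offers sh a → Serves ms as → Fits (mask , φ) (a ∷ as) →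
  totals (a ∷ as) ≤ lim → spents (a ∷ as) + L ≤ bud → excesses (a ∷ as) ≤ exc →
  ∃[ ps ] ∃[ b ] (k ps b ≡ true × Goods (a ∷ as) ps × L ≤ b)

tryBox-sound : ∀ {P n} (mask : Vec Bool n) (φ : Masks n) {v} cs (ms : Vec (Menu P) n) {lim bud exc k} L a as →
  tryBox mask φ v cs ms (lim ∸ (v + lbs ms)) lim bud exc k ≡ true →
  v ≤ total a → Any (Matches a) cs → Serves ms as → Fits (mask , φ) (a ∷ as) →
  totals (a ∷ as) ≤ lim → spents (a ∷ as) + L ≤ bud → excesses (a ∷ as) ≤ exc →
  ∃[ ps ] ∃[ b ] (k ps b ≡ true × Goods (a ∷ as) ps × L ≤ b)

enter-sound : ∀ {P n} (φ : Masks n) {v} c (ms : Vec (Menu P) n) {lim bud exc k} L a as →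
  enter φ v c ms lim bud exc k ≡ true →
  v ≤ total a → Matches a c → Serves ms as → Fits φ as →
  totals (a ∷ as) ≤ lim → spents (a ∷ as) + L ≤ bud → excesses (a ∷ as) ≤ exc →
  ∃[ ps ] ∃[ b ] (k ps b ≡ true × Goods (a ∷ as) ps × L ≤ b)

refute-sound φ       []       L []       eq _       _   _  bb _  = [] , _ , eq , tt , bb
refute-sound (m , φ) (_ ∷ ms) L (a ∷ as) eq (s , r) fit tb bb eb =
  tryShelf-sound m φ _ ms L a as eq (offer s) r fit tb bb eb

tryShelf-sound mask φ ((v , cs) ∷ sh) ms L a as eq (here (v≤t , q)) r fit tb bb eb =
  tryBox-sound mask φ cs ms L a as
    (then⁻ (≤⇒true (≤-trans (+-mono-≤ v≤t (lbs≤totals ms as r)) tb)) (proj₁ (∧⁻ _ eq)))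
    v≤t q r fit tb bb eb
tryShelf-sound mask φ ((v , cs) ∷ sh) ms L a as eq (there o) r fit tb bb eb =
  tryShelf-sound mask φ sh ms L a as (proj₂ (∧⁻ _ eq)) o r fit tb bb eb

tryBox-sound mask φ {v} (c ∷ cs) ms {lim} L a as eq v≤t (here q@(refl , own≤ , _)) r (al , fit) tb bb eb =
  enter-sound φ c _ L a as
    (then⁻ (≤⇒true (≤-trans (pred-mono-≤ own≤) (≤-trans (m≤m+n _ _) eb))) (proj₁ (∧⁻ _ eq)))
    v≤t q
    (narrow-serves _ _ mask ms as r al (≤-trans (∸-mono-+ v≤t tb) room)) fit tb bb eb
  where
  room : lim ∸ v ≤ lbs ms + (lim ∸ (v + lbs ms))
  room = subst (λ z → lim ∸ v ≤ lbs ms + z) (∸-+-assoc lim v (lbs ms)) (m≤n+m∸n (lim ∸ v) (lbs ms))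
tryBox-sound mask φ (c ∷ cs) ms L a as eq v≤t (there q) r fit tb bb eb =
  tryBox-sound mask φ cs ms L a as (proj₂ (∧⁻ _ eq)) v≤t q r fit tb bb eb

enter-sound φ c ms L a as eq v≤t (_ , own≤ , good) r fit tb bb eb
  with refute-sound φ ms L as
         (then⁻ (≤⇒true (≤-trans (+-mono-≤ v≤t (lbs≤totals ms as r)) tb)) eq)
         r fit (∸-mono-+ v≤t tb)
         (∸-mono-+ own≤ (≤-trans (≤-reflexive (sym (+-assoc (spent a) (spents as) L))) bb))
         (∸-mono-+ (pred-mono-≤ own≤) eb)
... | ps , b , eq′ , goods , L≤b = _ ∷ ps , b , eq′ , (good , goods) , L≤b

-- Soundness of the trees of paths

pathCost : ∀ {n} → Vec Line n → ℕ
pathCost []      = 0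
pathCost (l ∷ p) = cost l + pathCost p

follow : ∀ {n} → Line → Vec Line n → Actual (Tree n)
InTree : ∀ {n} → Vec Line n → Tree n → Set

follow l p = record { there-is = l ; spent = cost l ; later = pathCost p ; Good = InTree p }

InTree []      _ = ⊤
InTree (l ∷ p) m = m ∋ follow l p

Linked : ∀ {n} → Line → Vec Line n → Line → Set
-- This way round because `near id e` tests the last line so.
Linked s []      e = compat e s ≡ true
Linked s (l ∷ p) e = compat s l ≡ true × Linked l p e

Holds : ∀ {n} → Shelf Line → Vec Line n → Set
Holds sh []      = ⊤
Holds sh (l ∷ p) = (Shelved (cost l) (_≡ l) sh × 1 ≤ cost l) × Holds sh p

length≤pathCost : ∀ {n sh} (p : Vec Line n) → Holds sh p → n ≤ pathCost p
length≤pathCost []      _             = z≤n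
length≤pathCost (l ∷ p) ((_ , c) , h) = +-mono-≤ c (length≤pathCost p h)

module _ {n : ℕ} {l : Line} {p : Vec Line (suc n)} where

  extendBox-there : ∀ k v ls sh {acc} → Offers acc (follow l p) → Offers (extendBox k v ls sh acc) (follow l p)
  extendBox-there k v []       sh o = o
  extendBox-there k v (x ∷ ls) sh o with within ln k x sh
  ... | []    = extendBox-there k v ls sh o
  ... | _ ∷ _ = insert-there (extendBox-there k v ls sh o)

extendBox⁺ : ∀ {n k l h} (p : Vec Line n) ls sh {acc} → Any (_≡ l) ls → Offers sh (follow h p) →
             compat l h ≡ true → pathCost (h ∷ p) ≤ k →
             Offers (extendBox k (cost l) ls sh acc) (follow l (h ∷ p))
extendBox⁺ {k = k} {l} p (_ ∷ ls) sh {acc} (here refl) o lh le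
  with within ln k l sh | within⁺ {Q = Matches (follow _ p)} {f = ln} {l = l} (λ { (refl , _) → lh }) le o
... | sh′@(_ ∷ _) | o′ =
  insert⁺ (extendBox k (cost l) ls sh acc) (+-monoʳ-≤ (cost l) (least≤ o′)) (refl , ≤-refl , mkMenu-∋ o′)
extendBox⁺ {k = k} p (x ∷ ls) sh (there i) o lh le with within ln k x sh
... | []    = extendBox⁺ p ls sh i o lh le
... | _ ∷ _ = insert-there (extendBox⁺ p ls sh i o lh le)

extend⁺ : ∀ {n bud l h} (p : Vec Line n) cs sh → Shelved (cost l) (_≡ l) cs → Offers sh (follow h p) →
          compat l h ≡ true → cost l + pathCost (h ∷ p) ≤ bud → Offers (extend bud cs sh) (follow l (h ∷ p))
extend⁺ {l = l} {h} p ((_ , ls) ∷ cs) sh (here (refl , i)) o lh le =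
  extendBox⁺ p ls sh i o lh (∸-mono-+ {w = cost l} ≤-refl le)
extend⁺ p ((v , ls) ∷ cs) sh (there s) o lh le =
  extendBox-there _ v ls sh (extend⁺ p cs sh s o lh le)

tails⁺ : ∀ n {bud e} sh l (p : Vec Line n) → Holds sh (l ∷ p) → Linked l p e →
         cost l + pathCost p ≤ bud → Offers (tails n bud e sh) (follow l p)
tails⁺ zero    sh l []      ((s , _) , _) lk le =
  options⁺ (m≤m+n (cost l) 0) (λ { refl → refl , ≤-refl , tt }) (near⁺ (λ { refl → lk }) s)
tails⁺ (suc n) sh l (h ∷ p) ((s , c) , hs) (lh , lk) le =
  extend⁺ p sh _ s (tails⁺ n sh h p hs lk (∸-mono-+ c le)) lh le

holds-upTo : ∀ {m sh} k l (p : Vec Line m) → Holds sh (l ∷ p) → cost l + pathCost p ≤ k + m → Holds (upTo k sh) (l ∷ p)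
holds-upTo {m} {sh} k l p ((s , c) , hs) le =
  (upTo⁺ (+-cancelʳ-≤ m (cost l) k (≤-trans (+-monoʳ-≤ (cost l) (length≤pathCost p hs)) le)) s , c) , rest′ p hs le
  where
  rest′ : ∀ {m} (p : Vec Line m) → Holds sh p → cost l + pathCost p ≤ k + m → Holds (upTo k sh) p
  rest′ []      _  _  = tt
  rest′ {suc m} (h ∷ p) hs le =
    holds-upTo k h p hs (s≤s⁻¹ (≤-trans (+-monoˡ-≤ _ c) (≤-trans le (≤-reflexive (+-suc k m)))))

pathTree⁺ : ∀ n {bud s e} nbs (p : Vec Line (suc (suc n))) → Holds nbs p → Linked s p e →
            pathCost p ≤ bud → InTree p (pathTree n nbs s e bud)
pathTree⁺ n {bud} nbs (l ∷ p@(h ∷ q)) hs (sl , lh , lk) le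
  with holds-upTo (bud ∸ suc n) l p hs (≤-trans le (≤-trans (m≤n+m∸n bud (suc n)) (≤-reflexive (+-comm (suc n) _))))
... | (s , c) , hs′ =
  mkMenu-∋ (extend⁺ q _ _ (near⁺ (λ { refl → sl }) s) (tails⁺ n _ h q hs′ lk (∸-mono-+ c le)) lh le)

record Valid {n} (p : Vec Line n) (P : Paths n) : Set where
  constructor valid
  field
    shortest≤ : shortest P ≤ pathCost p
    inForest  : ∀ s → s < 4 → pathCost p ≤ shortest P + s → InTree p (select s P)
open Valid

-- A path within the budget would be offered by the tree, so an empty tree shows that the next
-- budget is a lower bound too.
search-≤ : ∀ n {s e nbs} (p : Vec Line (suc (suc n))) fuel bud → Holds nbs p → Linked s p e →
           bud ≤ pathCost p → search n nbs s e fuel bud ≤ pathCost p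
search-≤ n p zero bud hs lk le = le
search-≤ n {s} {e} {nbs} p@(_ ∷ _) (suc fuel) bud hs lk le
  with items (pathTree n nbs s e bud) in eq
... | _ ∷ _ = le
... | [] with pathCost p ≤? bud
...   | no  c≰ = search-≤ n p fuel (suc bud) hs lk (≰⇒> c≰)
...   | yes c≤ with subst (λ sh → Offers sh _) eq (offer (pathTree⁺ n nbs p hs lk c≤))
...     | ()

mkPaths-valid : ∀ n {s e nbs} (p : Vec Line (suc (suc n))) fuel → Holds nbs p → Linked s p e →
                Valid p (mkPaths n nbs s e fuel)
mkPaths-valid n {s} {e} {nbs} p fuel hs lk = valid
  (search-≤ n p fuel _ hs lk (length≤pathCost p hs))
  λ where
    0 _ le → tree 0 le
    1 _ le → tree 1 le
    2 _ le → tree 2 le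
    3 _ le → tree 3 le
    (suc (suc (suc (suc _)))) (s≤s (s≤s (s≤s (s≤s ())))) _
  where
  k = search n nbs s e fuel (suc (suc n))
  tree : ∀ i → pathCost p ≤ k + i → InTree p (pathTree n nbs s e (i + k))
  tree i le = pathTree⁺ n nbs p hs lk (≤-trans le (≤-reflexive (+-comm k i)))

-- The positions of the wheel and sums over them

W : Set
W = Fin 6

infix 4 _—_
_—_ : W → W → Set
i — j = Graph._~_ W₅ (Graph.vertex W₅ i) (Graph.vertex W₅ j)

-- The order of `wheel`: after the hub and 0 every position has an earlier neighbour on the rim,
-- whose line narrows its menu.
order : Vec W 6
order = 5F ∷ 0F ∷ 1F ∷ 4F ∷ 2F ∷ 3F ∷ []

∑ : (W → ℕ) → ℕ
∑ f = Vec.sum (Vec.map f order)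

fits : ∀ {P} (f : W → Actual P) → (∀ {i j} → i — j → compat (there-is (f i)) (there-is (f j)) ≡ true) →
       Fits wheel (Vec.map f order)
fits f ok =
  (yes′ tt , yes′ tt , yes′ tt , yes′ tt , yes′ tt , tt) ,
  (yes′ {0F} {1F} (inj₁ refl) , yes′ {0F} {4F} (inj₂ refl) , no′ , no′ , tt) ,
  (no′ , yes′ {1F} {2F} (inj₁ refl) , no′ , tt) ,
  (no′ , yes′ {4F} {3F} (inj₂ refl) , tt) ,
  (yes′ {2F} {3F} (inj₁ refl) , tt) , tt , tt
  where
  yes′ : ∀ {i j} → i — j → true ≡ true → compat (there-is (f i)) (there-is (f j)) ≡ true
  yes′ e _ = ok e
  no′ : ∀ {A : Set} → false ≡ true → A
  no′ ()

totals-split : ∀ {P n} (as : Vec (Actual P) n) → spents as + laters as ≡ totals as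
totals-split []       = refl
totals-split (a ∷ as) =
  trans (interchange (spent a) (spents as) (later a) (laters as)) (cong (total a +_) (totals-split as))

-- The totals split into what is spent now and what comes later, so one number can serve as limit
-- and as budget, and what is left of it covers the later costs.
refute-wheel : ∀ {P} (ms : Vec (Menu P) 6) {bud exc k} (f : W → Actual P) →
  refute wheel ms bud bud exc k ≡ true → Serves ms (Vec.map f order) →
  (∀ {i j} → i — j → compat (there-is (f i)) (there-is (f j)) ≡ true) →
  ∑ (total ∘ f) ≤ bud → ∑ (pred ∘ spent ∘ f) ≤ exc →
  ∃[ ps ] ∃[ b ] (k ps b ≡ true × Goods (Vec.map f order) ps × ∑ (later ∘ f) ≤ b)
refute-wheel ms f eq r ok tb eb =
  refute-sound wheel ms _ (Vec.map f order) eq r (fits f ok) tb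
    (≤-trans (≤-reflexive (totals-split (Vec.map f order))) tb) eb

sumOver : ∀ {n} → Vec W n → (W → ℕ) → ℕ
sumOver xs f = Vec.sum (Vec.map f xs)

sumOver-+ : ∀ {n} (xs : Vec W n) f g → sumOver xs (λ x → f x + g x) ≡ sumOver xs f + sumOver xs g
sumOver-+ []       f g = refl
sumOver-+ (x ∷ xs) f g = trans (cong (f x + g x +_) (sumOver-+ xs f g))
  (sym (interchange (f x) (sumOver xs f) (g x) (sumOver xs g)))

sumOver-mono : ∀ {n} (xs : Vec W n) {f g} → (∀ x → f x ≤ g x) → sumOver xs f ≤ sumOver xs g
sumOver-mono []       le = z≤n
sumOver-mono (x ∷ xs) le = +-mono-≤ (le x) (sumOver-mono xs le)

sumOver-pred : ∀ {n} (xs : Vec W n) {f} → (∀ x → 1 ≤ f x) → sumOver xs (pred ∘ f) + n ≡ sumOver xs f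
sumOver-pred []                _ = refl
sumOver-pred {suc n} (x ∷ xs) {f} pos = trans (lemma (f x) (pos x) (sumOver xs (pred ∘ f)))
  (cong (f x +_) (sumOver-pred xs pos))
  where
  lemma : ∀ m → 1 ≤ m → ∀ s → pred m + s + suc n ≡ m + (s + n)
  lemma (suc m) _ s = trans (+-suc (m + s) n) (cong suc (+-assoc m s n))

sumOver-member : ∀ {n} (xs : Vec W n) f {x} → x Vec.∈ xs → f x ≤ sumOver xs f
sumOver-member (_ ∷ xs) f (here refl) = m≤m+n (f _) _
sumOver-member (y ∷ xs) f (there i)   = ≤-trans (sumOver-member xs f i) (m≤n+m _ (f y))

∈-order : ∀ x → x Vec.∈ order
∈-order 5F = here refl
∈-order 0F = there (here refl)
∈-order 1F = there (there (here refl))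
∈-order 4F = there (there (there (here refl)))
∈-order 2F = there (there (there (there (here refl))))
∈-order 3F = there (there (there (there (there (here refl)))))

-- Soundness of the search on three factors

nodes⁺ : ∀ {f v l} sh → Shelved v (_≡ l) sh → Shelved v (_≡ node l (f l)) (nodes f sh)
nodes⁺ (_ ∷ sh) (here (eq , i)) = here (eq , map⁺ (Any.map (cong _) i))
nodes⁺ (_ ∷ sh) (there s)       = there (nodes⁺ sh s)

lines⁺ : ∀ {v n} ns → Shelved v (_≡ n) ns → Shelved v (_≡ at n) (lines ns)
lines⁺ (_ ∷ ns) (here (eq , i)) = here (eq , map⁺ (Any.map (cong at) i))
lines⁺ (_ ∷ ns) (there s)       = there (lines⁺ ns s)

-- The factor 2 is there because the hub plane occurs in the sum of all layers and once more.
above : Line → Vec Line 3 → Actual (Paths 3)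
above h p = record { there-is = h ; spent = 2 * cost h ; later = pathCost p ; Good = Valid p }

module _ {a b : Line} where
  open Hubs a b

  addBox-there : ∀ {v a} hs {acc} → Offers acc a → Offers (addBox v hs acc) a
  addBox-there []       o = o
  addBox-there (h ∷ hs) o = insert-there (addBox-there hs o)

  addBox⁺ : ∀ {h nbs p} hs {acc} → Any (_≡ node h nbs) hs → Holds nbs p → Linked b p a →
            Offers (addBox (cost h) hs acc) (above h p)
  addBox⁺ {h} {nbs} {p} (_ ∷ hs) (here refl) hold lk =
    insert⁺ (addBox (cost h) hs _) (+-monoʳ-≤ (2 * cost h) (shortest≤ ok)) (refl , ≤-refl , ok)
    where ok = mkPaths-valid 1 {nbs = nbs} p (fuelFor (cost h)) hold lk
  addBox⁺ (_ ∷ hs) (there i) hold lk = insert-there (addBox⁺ hs i hold lk)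

  hubs⁺ : ∀ {h nbs p} sh → Shelved (cost h) (_≡ node h nbs) sh → Holds nbs p → Linked b p a →
          Offers (hubs sh) (above h p)
  hubs⁺ ((_ , hs) ∷ sh) (here (refl , i)) hold lk = addBox⁺ hs i hold lk
  hubs⁺ ((_ , hs) ∷ sh) (there s)         hold lk = addBox-there hs (hubs⁺ sh s hold lk)

-- L x z is the line in the second direction of a configuration on W₅ □ W₅ □ W₅.
module Cube (L : W → W → Line) (pos : ∀ x z → 1 ≤ cost (L x z))
            (row : ∀ z {i j} → i — j → compat (L i z) (L j z) ≡ true)
            (col : ∀ x {i j} → i — j → compat (L x i) (L x j) ≡ true) where

  layer excess : W → ℕ
  layer  z = ∑ (λ x → cost (L x z))
  excess z = ∑ (λ x → pred (cost (L x z)))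

  -- Every line has a gap, so bounding the excess is how a bound for a single plane enters the
  -- search.
  excess+6 : ∀ z → excess z + 6 ≡ layer z
  excess+6 z = sumOver-pred order (λ x → pos x z)

  excess≤layer : ∀ z → excess z ≤ layer z
  excess≤layer z = ≤-trans (m≤m+n (excess z) 6) (≤-reflexive (excess+6 z))

  excess≤ : ∀ z k → layer z ≤ k + 6 → excess z ≤ k
  excess≤ z k le = +-cancelʳ-≤ 6 (excess z) k (≤-trans (≤-reflexive (excess+6 z)) le)

  cost≤ : ∀ z k → layer z ≤ k + 6 → ∀ x → cost (L x z) ≤ suc k
  cost≤ z k le x = pred≤⇒≤suc (cost (L x z)) (≤-trans (sumOver-member order (λ x → pred (cost (L x z))) (∈-order x)) (excess≤ z k le))
    where
    pred≤⇒≤suc : ∀ c → pred c ≤ k → c ≤ suc k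
    pred≤⇒≤suc zero    _ = z≤n
    pred≤⇒≤suc (suc c) h = s≤s h

  path : ∀ {n} → Vec W n → W → Vec Line n
  path zs x = Vec.map (L x) zs

  pathCosts : ∀ {n} (zs : Vec W n) → ∑ (pathCost ∘ path zs) ≡ Vec.sum (Vec.map layer zs)
  pathCosts []       = refl
  pathCosts (z ∷ zs) =
    trans (sumOver-+ order (λ x → cost (L x z)) (pathCost ∘ path zs)) (cong (layer z +_) (pathCosts zs))

  Each : ∀ {n} {A : Set} → (W → A → Set) → Vec W n → Vec A n → Set
  Each P []       []       = ⊤
  Each P (x ∷ xs) (a ∷ as) = P x a × Each P xs as

  Each-map : ∀ {n} {A B : Set} {P : W → A → Set} {Q : W → B → Set} {f : A → B} → (∀ {x a} → P x a → Q x (f a)) →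
             ∀ (xs : Vec W n) as → Each P xs as → Each Q xs (Vec.map f as)
  Each-map g []       []       _       = tt
  Each-map g (x ∷ xs) (a ∷ as) (p , e) = g p , Each-map g xs as e

  Each⇒Serves : ∀ {n P} (f : W → Actual P) (xs : Vec W n) ms → Each (λ x m → m ∋ f x) xs ms → Serves ms (Vec.map f xs)
  Each⇒Serves f []       []       _       = tt
  Each⇒Serves f (x ∷ xs) (m ∷ ms) (s , e) = s , Each⇒Serves f xs ms e

  Goods⇒Each : ∀ {n P} (f : W → Actual P) (xs : Vec W n) ps →
               Goods (Vec.map f xs) ps → Each (λ x p → Good (f x) p) xs ps
  Goods⇒Each f []       []       _       = tt
  Goods⇒Each f (x ∷ xs) (p ∷ ps) (g , e) = g , Goods⇒Each f xs ps e

  Caps : ∀ {n} → Vec W n → Vec ℕ n → Set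
  Caps []       []       = ⊤
  Caps (z ∷ zs) (e ∷ es) = excess z ≤ e × Caps zs es

  refuteTrees-sound : ∀ {n} (zs : Vec W n) ts {bud} es → refuteTrees n ts bud es ≡ true →
    Each (λ x → InTree (path zs x)) order ts → ∑ (pathCost ∘ path zs) ≤ bud → Caps zs es → ⊥
  refuteTrees-sound []       ts []       ()
  refuteTrees-sound (z ∷ zs) ts (e ∷ es) eq each le (c , cs)
    with refute-wheel ts (λ x → follow (L x z) (path zs x)) eq
           (Each⇒Serves (λ x → follow (L x z) (path zs x)) order ts each) (row z) le c
  ... | us , _ , eq′ , goods , le′ =
    refuteTrees-sound zs us es eq′ (Goods⇒Each (λ x → follow (L x z) (path zs x)) order us goods) le′ cs

  module _ {n : ℕ} {p : W → Vec Line n} where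

    shortests≤ : ∀ {m} (xs : Vec W m) ps → Each (Valid ∘ p) xs ps → shortests ps ≤ sumOver xs (pathCost ∘ p)
    shortests≤ []       []       _       = z≤n
    shortests≤ (x ∷ xs) (q ∷ qs) (v , e) = +-mono-≤ (shortest≤ v) (shortests≤ xs qs e)

    select-valid : ∀ {m} s → s < 4 → (xs : Vec W m) → ∀ ps → Each (Valid ∘ p) xs ps →
                   sumOver xs (pathCost ∘ p) ≤ shortests ps + s → Each (InTree ∘ p) xs (Vec.map (select s) ps)
    select-valid s s<4 []       []       _       _  = tt
    select-valid s s<4 (x ∷ xs) (q ∷ qs) (v , e) le with share s (shortest≤ v) (shortests≤ xs qs e) le
    ... | le₁ , le₂ = inForest v s s<4 le₁ , select-valid s s<4 xs qs e le₂

  refutePaths-sound : ∀ {n} (zs : Vec W n) es ps {bud} → refutePaths n es ps bud ≡ true →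
    Each (Valid ∘ path zs) order ps → ∑ (pathCost ∘ path zs) ≤ bud → Caps zs es → ⊥
  refutePaths-sound {n} zs es ps {bud} eq each le caps with bud <ᵇ shortests ps in lt
  ... | true  =
    <⇒≱ (<ᵇ⇒< bud (shortests ps) (subst T (sym lt) tt)) (≤-trans (shortests≤ {p = path zs} order ps each) le)
  ... | false with s<4 , eq′ ← ∧⁻ (bud ∸ shortests ps <ᵇ 4) eq =
    refuteTrees-sound zs _ es eq′
      (select-valid {p = path zs} (bud ∸ shortests ps) (<ᵇ⇒< _ 4 (subst T (sym s<4) tt)) order ps each
        (≤-trans le (m≤n+m∸n bud (shortests ps))))
      le caps

  Complete : Shelf Line → Set
  Complete sh = ∀ x z → Shelved (cost (L x z)) (_≡ L x z) sh

  Path : ∀ {n} → W → Vec W n → W → Set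
  Path s []       e = e — s
  Path s (z ∷ zs) e = s — z × Path z zs e

  linked : ∀ {n} x s (zs : Vec W n) e → Path s zs e → Linked (L x s) (path zs x) (L x e)
  linked x s []       e lk       = col x lk
  linked x s (z ∷ zs) e (k , lk) = col x k , linked x z zs e lk

  Over : ∀ {n} → W → Vec W n → Set
  Over h []       = ⊤
  Over h (z ∷ zs) = h — z × Over h zs

  holds : ∀ {n} sh → Complete sh → ∀ x h (zs : Vec W n) → Over h zs → Holds (near id (L x h) sh) (path zs x)
  holds sh comp x h []       _       = tt
  holds sh comp x h (z ∷ zs) (k , o) = (near⁺ (λ { refl → col x k }) (comp x z) , pos x z) , holds sh comp x h zs o

  module Refuted (reps sh : Shelf Line) (comp : Complete sh) (p q : W) (p—q : p — q)
                 (p≤7 : layer p ≤ 7) (q≤7 : layer q ≤ 7)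
                 (rep : Shelved (cost (L 5F p)) (_≡ L 5F p) reps)
                 (can : canonical (line (hubOf (L 0F p)) (hubOf (L 1F p)) (hubOf (L 2F p))
                                        (hubOf (L 3F p)) (hubOf (L 4F p)) (hubOf (L 5F p))) ≡ true) where

    cost≤2 : ∀ z → layer z ≤ 7 → ∀ x → cost (L x z) ≤ 2
    cost≤2 z le = cost≤ z 1 le

    ns : Shelf Node
    ns = nodes (λ l → near id l sh) sh

    nodeOf : W → W → Node
    nodeOf x z = node (L x z) (near id (L x z) sh)

    ns-complete : ∀ x z → Shelved (cost (L x z)) (_≡ nodeOf x z) ns
    ns-complete x z = nodes⁺ sh (comp x z)

    -- Stated for arbitrary `zs` and `h`, since the choice of two tight planes proceeds alike
    -- whether `p` is the hub or on the rim; the two cases then use one component each.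
    GoodPair : W → Pair → Set
    GoodPair x (P , m) =
      (∀ (zs : Vec W 4) → Over p zs → Path q zs q → Valid (path zs x) P) ×
      (∀ h (zs : Vec W 3) → p — h → q — h → cost (L x h) ≤ 4 → Over h zs → Path q zs p → m ∋ above (L x h) (path zs x))

    firstOf secondOf : W → Actual _
    secondOf x = record { there-is = L x q ; spent = cost (L x q) ; later = 0 ; Good = GoodPair x }
    firstOf  x = record { there-is = L x p ; spent = cost (L x p) ; later = 0
                        ; Good = λ f → front f ≡ L x p × seconds f ∋ secondOf x }

    pair-good : ∀ x → GoodPair x (pair (L x p) (lines (near at (L x p) ns)) (near at (L x p) ns) (L x q))
    pair-good x =
      (λ zs over lk → mkPaths-valid 2 {nbs = lines near-ns} (path zs x) 4 (holds′ zs over) (linked x q zs q lk)) ,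
      λ h zs p—h q—h h≤4 over lk →
                    mkMenu-∋ (hubs⁺ {nbs = near id (L x h) sh} _
                      (near⁺ (λ { refl → col x q—h }) (upTo⁺ h≤4 (near⁺ (λ { refl → col x p—h }) (ns-complete x h))))
                      (holds sh comp x h zs over) (linked x q zs p lk))
      where
      near-ns = near at (L x p) ns
      holds′ : ∀ {n} (zs : Vec W n) → Over p zs → Holds (lines near-ns) (path zs x)
      holds′ []       _       = tt
      holds′ (z ∷ zs) (k , o) =
        (lines⁺ near-ns (near⁺ (λ { refl → col x k }) (ns-complete x z)) , pos x z) , holds′ zs o

    mkFirst-good : ∀ x → Good (firstOf x) (mkFirst ns (L x p))
    mkFirst-good x = refl , mkMenu-∋ (options⁺ (m≤m+n _ 0) (λ { refl → refl , ≤-refl , pair-good x })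
      (upTo⁺ (cost≤2 q q≤7 x) (lines⁺ _ (near⁺ (λ { refl → col x p—q }) (ns-complete x q)))))

    offer-first : ∀ x shelf → Shelved (cost (L x p)) (_≡ L x p) shelf →
                  mkMenu (options id (mkFirst ns) shelf) ∋ firstOf x
    offer-first x shelf s = mkMenu-∋ (options⁺ (m≤m+n _ 0) (λ { refl → refl , ≤-refl , mkFirst-good x }) s)

    any-first : ∀ x → mkMenu (options id (mkFirst ns) (upTo 2 (lines ns))) ∋ firstOf x
    any-first x = offer-first x _ (upTo⁺ (cost≤2 p p≤7 x) (lines⁺ ns (ns-complete x p)))

    total≤7 : ∀ z → layer z ≤ 7 → ∑ (λ x → cost (L x z) + 0) ≤ 7
    total≤7 z le = ≤-trans (sumOver-mono order (λ x → ≤-reflexive (+-identityʳ (cost (L x z))))) le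

    excess≤1 : ∀ z → layer z ≤ 7 → excess z ≤ 1
    excess≤1 z = excess≤ z 1

    column-row : ∀ fs → Each (λ x → Good (firstOf x)) order fs →
      column fs ≡ line (hubOf (L 0F p)) (hubOf (L 1F p)) (hubOf (L 2F p))
                       (hubOf (L 3F p)) (hubOf (L 4F p)) (hubOf (L 5F p))
    column-row (f₅ ∷ f₀ ∷ f₁ ∷ f₄ ∷ f₂ ∷ f₃ ∷ [])
      ((refl , _) , (refl , _) , (refl , _) , (refl , _) , (refl , _) , (refl , _) , _) = refl

    Outcome : Set
    Outcome = ∃[ ps ] (refuteHub ps ≡ true × refuteRim ps ≡ true × Each GoodPair order ps)

    seconds-sound : ∀ fs → Each (λ x → Good (firstOf x)) order fs → refuteFirsts fs ≡ true → Outcome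
    seconds-sound fs each eq = conclude (refute-wheel (Vec.map seconds fs) secondOf
        (then⁻ (trans (cong canonical (column-row fs each)) can) eq)
        (Each⇒Serves secondOf order _ (Each-map proj₂ order fs each))
        (row q) (total≤7 q q≤7) (excess≤1 q q≤7))
      where
      conclude : ∃[ ps ] ∃[ b ] (refuteHub ps ∧ refuteRim ps ≡ true ×
                   Goods (Vec.map secondOf order) ps × 0 ≤ b) → Outcome
      conclude (ps , _ , eq , goods , _) =
        ps , proj₁ (∧⁻ (refuteHub ps) eq) , proj₂ (∧⁻ (refuteHub ps) eq) , Goods⇒Each secondOf order ps goods

    refuteCube-sound : refuteCube reps sh ≡ true → Outcome
    refuteCube-sound eq = conclude (refute-wheel _ firstOf eq
        (offer-first 5F reps rep , any-first 0F , any-first 1F , any-first 4F , any-first 2F , any-first 3F , tt)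
        (row p) (total≤7 p p≤7) (excess≤1 p p≤7))
      where
      conclude : ∃[ fs ] ∃[ b ] (refuteFirsts fs ≡ true × Goods (Vec.map firstOf order) fs × 0 ≤ b) → Outcome
      conclude (fs , _ , eq , goods , _) = seconds-sound fs (Goods⇒Each firstOf order fs goods) eq

  module _ {sh : Shelf Line} (comp : Complete sh) where

    layer≥7 : refutePlane sh ≡ true → ∀ z → 7 ≤ layer z
    layer≥7 eq z with 7 ≤? layer z
    ... | yes le = le
    ... | no  ≱7 = ⊥-elim (impossible (refute-wheel _ line-at eq
            (offered 5F , offered 0F , offered 1F , offered 4F , offered 2F , offered 3F , tt)
            -- 6 + 994 is `∞`, the cap with which `refutePlane` starts.
            (row z) total≤6 (≤-trans (excess≤layer z) (≤-trans layer≤6 (m≤m+n 6 994)))))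
      where
      layer≤6 : layer z ≤ 6
      layer≤6 = s≤s⁻¹ (≰⇒> ≱7)
      line-at : W → Actual ⊤
      line-at x = record { there-is = L x z ; spent = cost (L x z) ; later = 0 ; Good = λ _ → ⊤ }
      offered : ∀ x → mkMenu (options id (λ _ → tt) sh) ∋ line-at x
      offered x = mkMenu-∋ (options⁺ (m≤m+n _ 0) (λ { refl → refl , ≤-refl , tt }) (comp x z))
      total≤6 : ∑ (λ x → cost (L x z) + 0) ≤ 6
      total≤6 = ≤-trans (sumOver-mono order (λ x → ≤-reflexive (+-identityʳ (cost (L x z))))) layer≤6
      impossible : ∃[ ps ] ∃[ b ] (false ≡ true × Goods (Vec.map line-at order) ps × 0 ≤ b) → ⊥
      impossible (_ , _ , () , _)

  module _ (reps sh : Shelf Line) (comp : Complete sh) (eq : refuteCube reps sh ≡ true) where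

    hub-impossible : layer 5F ≤ 7 → layer 0F ≤ 7 → layer 1F ≤ 8 →
      layer 1F + (layer 2F + (layer 3F + (layer 4F + 0))) ≤ 32 →
      Shelved (cost (L 5F 5F)) (_≡ L 5F 5F) reps →
      canonical (line (hubOf (L 0F 5F)) (hubOf (L 1F 5F)) (hubOf (L 2F 5F))
                      (hubOf (L 3F 5F)) (hubOf (L 4F 5F)) (hubOf (L 5F 5F))) ≡ true → ⊥
    hub-impossible F₅ F₀ F₁ rest≤ rep can = conclude (refuteCube-sound eq)
      where
      open Refuted reps sh comp 5F 0F tt F₅ F₀ rep can
      zs : Vec W 4
      zs = 1F ∷ 2F ∷ 3F ∷ 4F ∷ []
      cap : ∀ z → z Vec.∈ zs → excess z ≤ ∞
      cap z i = ≤-trans (excess≤layer z) (≤-trans (sumOver-member zs layer i) (≤-trans rest≤ (m≤m+n 32 968)))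
      conclude : Outcome → ⊥
      conclude (ps , hub , _ , each) =
        refutePaths-sound zs (2 ∷ ∞ ∷ ∞ ∷ ∞ ∷ []) (Vec.map proj₁ ps) hub
          (Each-map (λ g → proj₁ g zs (tt , tt , tt , tt , tt) (0—1 , 1—2 , 2—3 , 3—4 , 0—4)) order ps each)
          (≤-trans (≤-reflexive (pathCosts zs)) rest≤)
          (excess≤ 1F 2 F₁ , cap 2F (there (here refl)) , cap 3F (there (there (here refl))) ,
           cap 4F (there (there (there (here refl)))) , tt)
        where
        0—1 = inj₁ refl
        1—2 = inj₁ refl
        2—3 = inj₁ refl
        3—4 = inj₁ refl
        0—4 = inj₂ refl

    rim-impossible : layer 0F ≤ 7 → layer 1F ≤ 7 → layer 5F ≤ 9 →
      (2 * layer 5F) + (layer 2F + (layer 3F + (layer 4F + 0))) ≤ 39 →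
      Shelved (cost (L 5F 0F)) (_≡ L 5F 0F) reps →
      canonical (line (hubOf (L 0F 0F)) (hubOf (L 1F 0F)) (hubOf (L 2F 0F))
                      (hubOf (L 3F 0F)) (hubOf (L 4F 0F)) (hubOf (L 5F 0F))) ≡ true → ⊥
    rim-impossible F₀ F₁ F₅ rest≤ rep can = conclude (refuteCube-sound eq)
      where
      open Refuted reps sh comp 0F 1F (inj₁ refl) F₀ F₁ rep can
      zs : Vec W 3
      zs = 2F ∷ 3F ∷ 4F ∷ []
      hub : W → Actual (Paths 3)
      hub x = above (L x 5F) (path zs x)
      double : ∑ (λ x → 2 * cost (L x 5F)) ≡ 2 * layer 5F
      double = trans (sumOver-+ order (λ x → cost (L x 5F)) (λ x → cost (L x 5F) + 0))
        (cong (layer 5F +_) (trans (sumOver-+ order (λ x → cost (L x 5F)) (λ _ → 0)) refl))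
      total≤39 : ∑ (total ∘ hub) ≤ 39
      total≤39 = ≤-trans (≤-reflexive (trans (sumOver-+ order (λ x → 2 * cost (L x 5F)) (pathCost ∘ path zs))
        (cong₂ _+_ double (pathCosts zs)))) rest≤
      excess≤12 : ∑ (pred ∘ spent ∘ hub) ≤ 12
      -- The six doubled costs add up to at most 2 · 9 = 18, and their predecessors to 6 less.
      excess≤12 = +-cancelʳ-≤ 6 _ 12 (≤-trans
        (≤-reflexive (trans (sumOver-pred order {λ x → 2 * cost (L x 5F)}
          (λ x → ≤-trans (pos x 5F) (m≤m+n (cost (L x 5F)) _))) double)) (*-monoʳ-≤ 2 F₅))
      small : ∀ z → z Vec.∈ zs → excess z ≤ ∞
      small z i = ≤-trans (excess≤layer z) (≤-trans (sumOver-member zs layer i)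
        (≤-trans (m≤n+m _ (2 * layer 5F)) (≤-trans rest≤ (m≤m+n 39 961))))
      finish : ∃[ qs ] ∃[ b ] (refutePaths 3 (∞ ∷ ∞ ∷ ∞ ∷ []) qs b ≡ true ×
                 Goods (Vec.map hub order) qs × ∑ (later ∘ hub) ≤ b) → ⊥
      finish (qs , b , eq′ , goods , le) =
        refutePaths-sound zs (∞ ∷ ∞ ∷ ∞ ∷ []) qs eq′ (Goods⇒Each hub order qs goods) le
          (small 2F (here refl) , small 3F (there (here refl)) , small 4F (there (there (here refl))) , tt)
      conclude : Outcome → ⊥
      conclude (ps , _ , rim , each) = finish (refute-wheel (Vec.map proj₂ ps) hub rim
        (Each⇒Serves hub order (Vec.map proj₂ ps)
          (Each-map (λ {x} g → proj₂ g 5F zs tt tt (cost≤ 5F 3 F₅ x) (tt , tt , tt , tt)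
                                 (inj₁ refl , inj₁ refl , inj₁ refl , inj₂ refl)) order ps each))
        (row 5F) total≤39 excess≤12)

-- Lines as colourings of the wheel, and evaluation over all lines

mk : (W → Colour) → Line
mk f = line (f 0F) (f 1F) (f 2F) (f 3F) (f 4F) (f 5F)

_!_ : Line → W → Colour
line a₀ a₁ a₂ a₃ a₄ h ! 0F = a₀
line a₀ a₁ a₂ a₃ a₄ h ! 1F = a₁
line a₀ a₁ a₂ a₃ a₄ h ! 2F = a₂
line a₀ a₁ a₂ a₃ a₄ h ! 3F = a₃
line a₀ a₁ a₂ a₃ a₄ h ! 4F = a₄
line a₀ a₁ a₂ a₃ a₄ h ! 5F = h

mk-! : ∀ f i → mk f ! i ≡ f i
mk-! f 0F = refl
mk-! f 1F = refl
mk-! f 2F = refl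
mk-! f 3F = refl
mk-! f 4F = refl
mk-! f 5F = refl

mk-cong : ∀ {f g : W → Colour} → (∀ i → f i ≡ g i) → mk f ≡ mk g
mk-cong eq rewrite eq 0F | eq 1F | eq 2F | eq 3F | eq 4F | eq 5F = refl

∧⁺ : ∀ {a b} → a ≡ true → b ≡ true → a ∧ b ≡ true
∧⁺ refl refl = refl

compat-mk : ∀ {f g : W → Colour} → (∀ i → agree (f i) (g i) ≡ true) → compat (mk f) (mk g) ≡ true
compat-mk ok = ∧⁺ (ok 0F) (∧⁺ (ok 1F) (∧⁺ (ok 2F) (∧⁺ (ok 3F) (∧⁺ (ok 4F) (ok 5F)))))

proper-mk : ∀ {f : W → Colour} → (∀ {i j} → i — j → agree (f i) (f j) ≡ true) → proper (mk f) ≡ true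
proper-mk ok =
  ∧⁺ (ok {0F} {1F} (inj₁ refl)) (∧⁺ (ok {1F} {2F} (inj₁ refl)) (∧⁺ (ok {2F} {3F} (inj₁ refl))
  (∧⁺ (ok {3F} {4F} (inj₁ refl)) (∧⁺ (ok {4F} {0F} (inj₁ refl))
  (∧⁺ (ok tt) (∧⁺ (ok tt) (∧⁺ (ok tt) (∧⁺ (ok tt) (ok tt)))))))))

∈-colours : ∀ c → c ∈ colours
∈-colours none  = here refl
∈-colours red   = there (here refl)
∈-colours green = there (there (here refl))
∈-colours blue  = there (there (there (here refl)))

∈-allLines : ∀ l → l ∈ allLines
∈-allLines (line a₀ a₁ a₂ a₃ a₄ h) =
  pick vary₄ a₀ (pick (vary₃ a₀) a₁ (pick (vary₂ a₀ a₁) a₂ (pick (vary₁ a₀ a₁ a₂) a₃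
    (pick (vary₀ a₀ a₁ a₂ a₃) a₄ (∈-map⁺ (line a₀ a₁ a₂ a₃ a₄) (∈-colours h))))))
  where
  vary₀ : (a b c d e : Colour) → List Line
  vary₀ a b c d e = map (line a b c d e) colours
  vary₁ : (a b c d : Colour) → List Line
  vary₁ a b c d = concatMap (vary₀ a b c d) colours
  vary₂ : (a b c : Colour) → List Line
  vary₂ a b c = concatMap (vary₁ a b c) colours
  vary₃ : (a b : Colour) → List Line
  vary₃ a b = concatMap (vary₂ a b) colours
  vary₄ : Colour → List Line
  vary₄ a = concatMap (vary₃ a) colours
  pick : ∀ {l} (f : Colour → List Line) c → l ∈ f c → l ∈ concatMap f colours
  pick {l} f c i = ∈-concatMap⁺ f {xs = colours} (Any.map (λ { refl → i }) (∈-colours c))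

-- Only the Booleans are evaluated for the 4096 lines; a proof is extracted just for the line in
-- question.
every : {P : Line → Set} (P? : ∀ l → Dec (P l)) → all (does ∘ P?) allLines ≡ true → ∀ l → P l
every P? eq l = witness (P? l) (all⁻ (does ∘ P?) allLines eq (∈-allLines l))
  where
  witness : ∀ {A : Set} (a? : Dec A) → does a? ≡ true → A
  witness (true because [a]) refl = invert [a]
  all⁻ : ∀ (f : Line → Bool) ls → all f ls ≡ true → ∀ {l} → l ∈ ls → f l ≡ true
  all⁻ f (l ∷ ls) eq (here refl) = proj₁ (∧⁻ (f l) eq)
  all⁻ f (l ∷ ls) eq (there i)   = all⁻ f ls (proj₂ (∧⁻ (f l) eq)) i

Range : Line → Set
Range l = proper l ≡ true → cost l ∈ (1 ∷ 2 ∷ 3 ∷ 4 ∷ 5 ∷ 6 ∷ [])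

range? : ∀ l → Dec (Range l)
range? l = (proper l Bool.≟ true) →-dec any? (cost l ≟_) (1 ∷ 2 ∷ 3 ∷ 4 ∷ 5 ∷ 6 ∷ [])

abstract
  cost-range : ∀ l → Range l
  cost-range = every range? refl

-- The wheel is not 3-colourable: its odd rim takes all three colours, and the hub would need a
-- fourth.
cost≥1 : ∀ l → proper l ≡ true → 1 ≤ cost l
cost≥1 l p with cost l | cost-range l p
... | _ | here refl = ≤-refl
... | _ | there (here refl) = s≤s z≤n
... | _ | there (there (here refl)) = s≤s z≤n
... | _ | there (there (there (here refl))) = s≤s z≤n
... | _ | there (there (there (there (here refl)))) = s≤s z≤n
... | _ | there (there (there (there (there (here refl))))) = s≤s z≤n

∈-linesOfCost : ∀ l → proper l ≡ true → l ∈ linesOfCost (cost l)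
∈-linesOfCost l p = ∈-filter⁺ (λ m → T? (proper m ∧ (cost m ≡ᵇ cost l))) (∈-allLines l)
  (Equivalence.from Bool.T-≡ (∧⁺ p (T⇒≡ (≡⇒≡ᵇ (cost l) (cost l) refl))))

lineShelf-complete : ∀ l → proper l ≡ true → Shelved (cost l) (_≡ l) lineShelf
lineShelf-complete l p = map⁺ {f = λ k → k , linesOfCost k}
  (Any.map (λ { refl → refl , Any.map sym (∈-linesOfCost l p) }) (cost-range l p))

-- Symmetries

record Symmetry : Set where
  field
    to     : W → W
    edges  : ∀ {i j} → i — j → to i — to j
    to-hub : to 5F ≡ 5F
    ∑-to   : ∀ f → ∑ (f ∘ to) ≡ ∑ f
open Symmetry

_—?_ : ∀ i j → Dec (i — j)
i —? j = Graph._~?_ W₅ (Graph.vertex W₅ i) (Graph.vertex W₅ j)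

identity rotation reflection : Symmetry
identity = record { to = id ; edges = id ; to-hub = refl ; ∑-to = λ _ → refl }
rotation = record
  { to     = ρ
  ; edges  = λ {i} {j} → toWitness {a? = allFin? λ i → allFin? λ j → (i —? j) →-dec (ρ i —? ρ j)} tt i j
  ; to-hub = refl
  ; ∑-to   = λ f → permuted (f 0F) (f 1F) (f 2F) (f 3F) (f 4F) (f 5F)
  }
  where
  ρ : W → W
  ρ 0F = 1F
  ρ 1F = 2F
  ρ 2F = 3F
  ρ 3F = 4F
  ρ 4F = 0F
  ρ 5F = 5F
  permuted : ∀ a b c d e h → h + (b + (c + (a + (d + (e + 0))))) ≡ h + (a + (b + (e + (c + (d + 0)))))
  permuted = solve-∀
reflection = record
  { to     = ρ
  ; edges  = λ {i} {j} → toWitness {a? = allFin? λ i → allFin? λ j → (i —? j) →-dec (ρ i —? ρ j)} tt i j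
  ; to-hub = refl
  ; ∑-to   = λ f → permuted (f 0F) (f 1F) (f 2F) (f 3F) (f 4F) (f 5F)
  }
  where
  ρ : W → W
  ρ 0F = 0F
  ρ 1F = 4F
  ρ 2F = 3F
  ρ 3F = 2F
  ρ 4F = 1F
  ρ 5F = 5F
  permuted : ∀ a b c d e h → h + (a + (e + (b + (d + (c + 0))))) ≡ h + (a + (b + (e + (c + (d + 0)))))
  permuted = solve-∀

infixr 9 _⊙_
_⊙_ : Symmetry → Symmetry → Symmetry
s ⊙ t = record
  { to     = to s ∘ to t
  ; edges  = edges s ∘ edges t
  ; to-hub = trans (cong (to s) (to-hub t)) (to-hub s)
  ; ∑-to   = λ f → trans (∑-to t (f ∘ to s)) (∑-to s f)
  }

turns : Symmetry → List Symmetry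
turns s = s ∷ s ⊙ rotation ∷ s ⊙ rotation ⊙ rotation ∷ s ⊙ rotation ⊙ rotation ⊙ rotation ∷
          s ⊙ rotation ⊙ rotation ⊙ rotation ⊙ rotation ∷ []

dihedral : List Symmetry
dihedral = turns identity ++ turns reflection

record Recolouring : Set where
  field
    to       : Colour → Colour
    agree-to : ∀ a b → agree (to a) (to b) ≡ agree a b
    gap-to   : ∀ a → gap (to a) ≡ gap a
open Recolouring renaming (to to recolour)

keep red⇄green green⇄blue : Recolouring
keep = record { to = id ; agree-to = λ _ _ → refl ; gap-to = λ _ → refl }
red⇄green = record
  { to = λ { none → none ; red → green ; green → red ; blue → blue }
  ; agree-to = λ { none _ → refl
                 ; red none → refl ; red red → refl ; red green → refl ; red blue → refl
                 ; green none → refl ; green red → refl ; green green → refl ; green blue → refl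
                 ; blue none → refl ; blue red → refl ; blue green → refl ; blue blue → refl }
  ; gap-to = λ { none → refl ; red → refl ; green → refl ; blue → refl } }
green⇄blue = record
  { to = λ { none → none ; red → red ; green → blue ; blue → green }
  ; agree-to = λ { none _ → refl
                 ; red none → refl ; red red → refl ; red green → refl ; red blue → refl
                 ; green none → refl ; green red → refl ; green green → refl ; green blue → refl
                 ; blue none → refl ; blue red → refl ; blue green → refl ; blue blue → refl }
  ; gap-to = λ { none → refl ; red → refl ; green → refl ; blue → refl } }

infixr 9 _⊚_
_⊚_ : Recolouring → Recolouring → Recolouring
σ ⊚ τ = record
  { to       = recolour σ ∘ recolour τ
  ; agree-to = λ a b → trans (agree-to σ _ _) (agree-to τ a b)
  ; gap-to   = λ a → trans (gap-to σ _) (gap-to τ a)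
  }

recolourings : List Recolouring
recolourings = keep ∷ red⇄green ∷ green⇄blue ∷ red⇄green ⊚ green⇄blue ∷ green⇄blue ⊚ red⇄green ∷
               red⇄green ⊚ green⇄blue ⊚ red⇄green ∷ []

act : Recolouring → Symmetry → Line → Line
act σ s l = mk (λ i → recolour σ (l ! to s i))

act-mk : ∀ σ s f → act σ s (mk f) ≡ mk (recolour σ ∘ f ∘ to s)
act-mk σ s f = mk-cong (λ i → cong (recolour σ) (mk-! f (to s i)))

_≟ᶜ_ : DecidableEquality Colour
a ≟ᶜ b = map′ (λ eq → trans (sym (decode-encode a)) (trans (cong decode eq) (decode-encode b)))
              (cong encode) (encode a ≟ encode b)
  where
  encode : Colour → ℕ
  encode none  = 0
  encode red   = 1
  encode green = 2
  encode blue  = 3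
  decode : ℕ → Colour
  decode 0 = none
  decode 1 = red
  decode 2 = green
  decode _ = blue
  decode-encode : ∀ c → decode (encode c) ≡ c
  decode-encode none  = refl
  decode-encode red   = refl
  decode-encode green = refl
  decode-encode blue  = refl

_≟ᴸ_ : DecidableEquality Line
l ≟ᴸ m = map′ (λ eq → trans (sym (mk-η l)) (trans (mk-cong eq) (mk-η m))) (λ eq i → cong (λ k → k ! i) eq)
              (allFin? (λ i → (l ! i) ≟ᶜ (m ! i)))
  where
  mk-η : ∀ l → mk (l !_) ≡ l
  mk-η (line _ _ _ _ _ _) = refl

IsRep : Line → Set
IsRep l = Shelved (cost l) (_≡ l) rowReps

isRep? : ∀ l → Dec (IsRep l)
isRep? l = any? (λ (v , ls) → (v ≟ cost l) ×-dec any? (_≟ᴸ l) ls) rowReps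

RowRep ColumnCanonical : Line → Set
RowRep l = proper l ≡ true → cost l ≤ 2 → Any (λ σ → Any (λ s → IsRep (act σ s l)) dihedral) recolourings
ColumnCanonical l = proper l ≡ true → Any (λ s → canonical (act keep s l) ≡ true) dihedral

rowRep? : ∀ l → Dec (RowRep l)
rowRep? l = (proper l Bool.≟ true) →-dec ((cost l ≤? 2) →-dec
  any? (λ σ → any? (λ s → isRep? (act σ s l)) dihedral) recolourings)

columnCanonical? : ∀ l → Dec (ColumnCanonical l)
columnCanonical? l = (proper l Bool.≟ true) →-dec any? (λ s → canonical (act keep s l) Bool.≟ true) dihedral

abstract
  row-rep : ∀ l → RowRep l
  row-rep = every rowRep? refl

  column-canonical : ∀ l → ColumnCanonical l
  column-canonical = every columnCanonical? refl

-- Abstract, so that these evaluations are not repeated where the facts are used.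
abstract
  plane-refuted : refutePlane lineShelf ≡ true
  plane-refuted = refl

  cube-refuted : refuteCube rowReps lineShelf ≡ true
  cube-refuted = refl

-- Three factors

record Colouring : Set where
  field
    colourAt : W → W → W → Colour
    okˣ : ∀ {i j} y z → i — j → agree (colourAt i y z) (colourAt j y z) ≡ true
    okʸ : ∀ {i j} x z → i — j → agree (colourAt x i z) (colourAt x j z) ≡ true
    okᶻ : ∀ {i j} x y → i — j → agree (colourAt x y i) (colourAt x y j) ≡ true

  lineAt : W → W → Line
  lineAt x z = mk (λ y → colourAt x y z)

  lineAt-proper : ∀ x z → proper (lineAt x z) ≡ true
  lineAt-proper x z = proper-mk (λ {i} {j} → okʸ {i} {j} x z)

  open Cube lineAt (λ x z → cost≥1 (lineAt x z) (lineAt-proper x z))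
            (λ z {i} {j} e → compat-mk (λ y → okˣ {i} {j} y z e))
            (λ x {i} {j} e → compat-mk (λ y → okᶻ {i} {j} x y e)) public

  complete : Complete lineShelf
  complete x z = lineShelf-complete (lineAt x z) (lineAt-proper x z)

  columnAt : W → Line
  columnAt z = mk (λ x → colourAt x 5F z)

open Colouring

∑-cong : ∀ {f g} → (∀ x → f x ≡ g x) → ∑ f ≡ ∑ g
∑-cong eq = ≤-antisym (sumOver-mono order (≤-reflexive ∘ eq)) (sumOver-mono order (≤-reflexive ∘ sym ∘ eq))

transform : Recolouring → (s t u : Symmetry) → Colouring → Colouring
transform σ s t u C = record
  { colourAt = λ x y z → recolour σ (colourAt C (to s x) (to t y) (to u z))
  ; okˣ = λ {i} {j} y z e → trans (agree-to σ _ _) (okˣ C {to s i} {to s j} _ _ (edges s {i} {j} e))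
  ; okʸ = λ {i} {j} x z e → trans (agree-to σ _ _) (okʸ C {to t i} {to t j} _ _ (edges t {i} {j} e))
  ; okᶻ = λ {i} {j} x y e → trans (agree-to σ _ _) (okᶻ C {to u i} {to u j} _ _ (edges u {i} {j} e))
  }

layer-transform : ∀ σ s t u C z → layer (transform σ s t u C) z ≡ layer C (to u z)
layer-transform σ s t u C z = trans
  (∑-cong λ x → trans (∑-cong λ y → gap-to σ (colourAt C (to s x) (to t y) (to u z)))
                      (∑-to t (λ y → gap (colourAt C (to s x) y (to u z)))))
  (∑-to s (λ x → ∑ λ y → gap (colourAt C x y (to u z))))

-- Symmetries in the first two directions, and of the colours, bring a tight
-- layer into the form from which the search starts.
Canonicalised : Colouring → W → Set
Canonicalised C z = ∃[ C′ ] ((∀ z → layer C′ z ≡ layer C z) ×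
  IsRep (lineAt C′ 5F z) × canonical (columnAt C′ z) ≡ true)

canonicalise : ∀ C z → layer C z ≤ 7 → Canonicalised C z
canonicalise C z tight = uncurry turn-row
  (Any.satisfied (row-rep (lineAt C 5F z) (lineAt-proper C 5F z) (cost≤ C z 1 tight 5F)))
  where
  module _ (σ : Recolouring) (t : Symmetry) (rep : IsRep (act σ t (lineAt C 5F z))) where
    C₁ = transform σ identity t identity C
    turn-column : ∀ s → canonical (act keep s (columnAt C₁ z)) ≡ true → Canonicalised C z
    turn-column s can = transform keep s identity identity C₁ ,
      (λ z → trans (layer-transform keep s identity identity C₁ z) (layer-transform σ identity t identity C z)) ,
      -- `s` fixes the hub, so turning the column preserves the form given to the row.
      subst IsRep (trans (act-mk σ t (λ y → colourAt C 5F y z))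
                         (mk-cong λ y → cong (λ x → colourAt C₁ x y z) (sym (to-hub s)))) rep ,
      trans (cong canonical (sym (act-mk keep s (λ x → colourAt C₁ x 5F z)))) can
    result : Canonicalised C z
    result = uncurry turn-column
      (Any.satisfied (column-canonical (columnAt C₁ z) (proper-mk (λ {i} {j} → okˣ C₁ {i} {j} 5F z))))
  turn-row : ∀ σ → Any (λ t → IsRep (act σ t (lineAt C 5F z))) dihedral → Canonicalised C z
  turn-row σ reps = uncurry (result σ) (Any.satisfied reps)

layer≥ : ∀ C z → 7 ≤ layer C z
layer≥ C = layer≥7 C (complete C) plane-refuted

-- For taking a plane with at least `v` gaps out of a total.
peel : ∀ {v w x lim} → v ≤ w → w + x ≤ v + lim → x ≤ lim
peel {v} {w} {x} {lim} v≤w le = +-cancelˡ-≤ v x lim (≤-trans (+-monoˡ-≤ x v≤w) le)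

hub-pair : ∀ C → ∑ (layer C) ≤ 46 → layer C 5F ≤ 7 → layer C 0F ≤ 7 → layer C 1F ≤ 8 → ⊥
hub-pair C total F₅ F₀ F₁ = refuted (canonicalise C 5F F₅)
  where
  reorder : ∀ a b c d → a + (b + (c + (d + 0))) ≡ a + (d + (b + (c + 0)))
  reorder = solve-∀
  refuted : Canonicalised C 5F → ⊥
  refuted (C′ , same , rep , can) = hub-impossible C′ rowReps lineShelf (complete C′) cube-refuted
    (moved F₅) (moved F₀) (moved F₁)
    (≤-trans (≤-reflexive (reorder (layer C′ 1F) (layer C′ 2F) (layer C′ 3F) (layer C′ 4F)))
      (peel {7} {lim = 32} (layer≥ C′ 0F) (peel {7} {lim = 39} (layer≥ C′ 5F)
        (≤-trans (≤-reflexive (∑-cong same)) total))))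
    rep can
    where
    moved : ∀ {z k} → layer C z ≤ k → layer C′ z ≤ k
    moved {z} = ≤-trans (≤-reflexive (same z))

rim-pair : ∀ C → ∑ (layer C) + layer C 5F ≤ 53 → layer C 0F ≤ 7 → layer C 1F ≤ 7 → ⊥
rim-pair C total F₀ F₁ = refuted (canonicalise C 0F F₀)
  where
  reorder₁ : ∀ a b c d e h → a + (b + (c + (d + (e + 2 * h)))) ≡ h + (a + (b + (e + (c + (d + 0))))) + h
  reorder₁ = solve-∀
  reorder₂ : ∀ a b c d e h → a + (b + (2 * h + (c + (d + (e + 0))))) ≡ h + (a + (b + (e + (c + (d + 0))))) + h
  reorder₂ = solve-∀
  refuted : Canonicalised C 0F → ⊥
  refuted (C′ , same , rep , can) = rim-impossible C′ rowReps lineShelf (complete C′) cube-refuted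
    (moved F₀) (moved F₁)
    -- The five rim planes leave at most 53 - 5 · 7 = 18 for twice the hub plane.
    (*-cancelˡ-≤ 2 (peel {7} {lim = 18} (ge 4F) (peel {7} {lim = 25} (ge 3F) (peel {7} {lim = 32} (ge 2F)
      (peel {7} {lim = 39} (ge 1F) (peel {7} {lim = 46} (ge 0F)
        (≤-trans (≤-reflexive (reorder₁ (F 0F) (F 1F) (F 2F) (F 3F) (F 4F) (F 5F))) total′)))))))
    (peel {7} {lim = 39} (ge 1F) (peel {7} {lim = 46} (ge 0F)
      (≤-trans (≤-reflexive (reorder₂ (F 0F) (F 1F) (F 2F) (F 3F) (F 4F) (F 5F))) total′)))
    rep can
    where
    F  = layer C′
    ge = layer≥ C′
    moved : ∀ {z k} → layer C z ≤ k → F z ≤ k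
    moved {z} = ≤-trans (≤-reflexive (same z))
    total′ : ∑ F + F 5F ≤ 53
    total′ = ≤-trans (≤-reflexive (cong₂ _+_ (∑-cong same) (same 5F))) total

rim : (W → ℕ) → ℕ
rim f = f 0F + (f 1F + (f 4F + (f 2F + (f 3F + 0))))

-- The five sums over adjacent rim positions add up to twice the rim, so not all of them can exceed
-- `k`.
adjacent-pair : ∀ (f : W → ℕ) k → rim f + rim f < 5 * suc k →
  ∃[ s ] (f (to s 0F) + f (to s 1F) ≤ k)
adjacent-pair f k small
  with f 0F + f 1F ≤? k | f 1F + f 2F ≤? k | f 2F + f 3F ≤? k | f 3F + f 4F ≤? k | f 4F + f 0F ≤? k
... | yes le | _ | _ | _ | _ = identity , le
... | no _ | yes le | _ | _ | _ = rotation , le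
... | no _ | no _ | yes le | _ | _ = rotation ⊙ rotation , le
... | no _ | no _ | no _ | yes le | _ = rotation ⊙ rotation ⊙ rotation , le
... | no _ | no _ | no _ | no _ | yes le = rotation ⊙ rotation ⊙ rotation ⊙ rotation , le
... | no a | no b | no c | no d | no e = ⊥-elim (<⇒≱ small (≤-trans
  (+-mono-≤ (≰⇒> a) (+-mono-≤ (≰⇒> b) (+-mono-≤ (≰⇒> c) (+-mono-≤ (≰⇒> d) (+-mono-≤ (≰⇒> e) z≤n)))))
  (≤-reflexive (double (f 0F) (f 1F) (f 2F) (f 3F) (f 4F)))))
  where
  double : ∀ a b c d e → (a + b) + ((b + c) + ((c + d) + ((d + e) + ((e + a) + 0)))) ≡
           (a + (b + (e + (c + (d + 0))))) + (a + (b + (e + (c + (d + 0)))))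
  double = solve-∀

turned : Colouring → Symmetry → Colouring
turned C u = transform keep identity identity u C

module _ (C : Colouring) where

  private
    F = layer C

  module _ (u : Symmetry) where

    turned-layer : ∀ z → layer (turned C u) z ≡ F (to u z)
    turned-layer = layer-transform keep identity identity u C

    turned-∑ : ∑ (layer (turned C u)) ≡ ∑ F
    turned-∑ = trans (∑-cong turned-layer) (∑-to u F)

    turned-hub : layer (turned C u) 5F ≡ F 5F
    turned-hub = trans (turned-layer 5F) (cong F (to-hub u))

  hub-tight : ∑ F ≤ 46 → F 5F ≤ 7 → ⊥
  -- 2 · 39 = 78 is less than 80 = 5 · 16. A pair with at most 15 gaps consists of a plane with 7
  -- and one with at most 8.
  hub-tight total hub = uncurry step (adjacent-pair F 15 (s≤s (≤-trans (+-mono-≤ rim≤39 rim≤39) (n≤1+n 78))))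
    where
    rim≤39 : rim F ≤ 39
    rim≤39 = peel {7} {lim = 39} (layer≥ C 5F) total
    apply : ∀ u → F (to u 0F) ≤ 7 → F (to u 1F) ≤ 8 → ⊥
    apply u a b = hub-pair (turned C u) (≤-trans (≤-reflexive (turned-∑ u)) total)
      (≤-trans (≤-reflexive (turned-hub u)) hub)
      (≤-trans (≤-reflexive (turned-layer u 0F)) a) (≤-trans (≤-reflexive (turned-layer u 1F)) b)
    step : ∀ u → F (to u 0F) + F (to u 1F) ≤ 15 → ⊥
    step u le with F (to u 0F) ≤? 7
    ... | yes a = apply u a (peel {7} {lim = 8} (layer≥ C (to u 0F)) le)
    -- `rotation ⊙ reflection` exchanges 0 and 1, which puts the tight plane first.
    ... | no  a = apply (u ⊙ rotation ⊙ reflection) (peel {8} {lim = 7} (≰⇒> a) le)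
                    (peel {7} {lim = 8} (layer≥ C (to u 1F)) (≤-trans (≤-reflexive (+-comm (F (to u 1F)) _)) le))

  hub-loose : ∑ F + F 5F ≤ 53 → 8 ≤ F 5F → ⊥
  -- The rim has at most 53 - 2 · 8 = 37 gaps, and 2 · 37 = 74 is less than 75 = 5 · 15. A pair with
  -- at most 14 gaps is tight in both planes.
  hub-loose total hub = uncurry step (adjacent-pair F 14 (s≤s (+-mono-≤ rim≤37 rim≤37)))
    where
    step : ∀ u → F (to u 0F) + F (to u 1F) ≤ 14 → ⊥
    step u pair≤14 = rim-pair (turned C u) (≤-trans (≤-reflexive (cong₂ _+_ (turned-∑ u) (turned-hub u))) total)
      (≤-trans (≤-reflexive (turned-layer u 0F)) (peel {7} {lim = 7} (layer≥ C (to u 1F))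
        (≤-trans (≤-reflexive (+-comm (F (to u 1F)) _)) pair≤14)))
      (≤-trans (≤-reflexive (turned-layer u 1F)) (peel {7} {lim = 7} (layer≥ C (to u 0F)) pair≤14))
    rim≤37 : rim F ≤ 37
    rim≤37 = peel {8} {lim = 37} hub (peel {8} {lim = 45} hub (≤-trans (≤-reflexive (+-comm (F 5F) _)) total))

  layers≥54 : 54 ≤ ∑ F + F 5F
  layers≥54 with 54 ≤? ∑ F + F 5F
  ... | yes le = le
  ... | no  ≱54 with F 5F ≤? 7
  ...   | no  loose = ⊥-elim (hub-loose (s≤s⁻¹ (≰⇒> ≱54)) (≰⇒> loose))
  ...   | yes tight = ⊥-elim (hub-tight (peel {7} {lim = 46} (layer≥ C 5F)
            (≤-trans (≤-reflexive (+-comm (F 5F) _)) (s≤s⁻¹ (≰⇒> ≱54)))) tight)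

-- Four factors

sumOver-0 : ∀ {n} (xs : Vec W n) → sumOver xs (λ _ → 0) ≡ 0
sumOver-0 []       = refl
sumOver-0 (_ ∷ xs) = sumOver-0 xs

sumOver-swap : ∀ {m n} (xs : Vec W m) (ys : Vec W n) (f : W → W → ℕ) →
  sumOver xs (λ x → sumOver ys (f x)) ≡ sumOver ys (λ y → sumOver xs (λ x → f x y))
sumOver-swap []       ys f = sym (sumOver-0 ys)
sumOver-swap (x ∷ xs) ys f = trans (cong (sumOver ys (f x) +_) (sumOver-swap xs ys f))
  (sym (sumOver-+ ys (f x) (λ y → sumOver xs (λ x → f x y))))

module _ (c : W → W → W → W → Colour)
         (ok₁ : ∀ {i j} y z w → i — j → agree (c i y z w) (c j y z w) ≡ true)
         (ok₂ : ∀ {i j} x z w → i — j → agree (c x i z w) (c x j z w) ≡ true)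
         (ok₃ : ∀ {i j} x y w → i — j → agree (c x y i w) (c x y j w) ≡ true)
         (ok₄ : ∀ {i j} x y z → i — j → agree (c x y z i) (c x y z j) ≡ true) where

  plane : W → W → ℕ
  plane z w = ∑ λ x → ∑ λ y → gap (c x y z w)

  slice₄ slice₃ : W → Colouring
  slice₄ w = record { colourAt = λ x y z → c x y z w ; okˣ = λ {i} {j} y z → ok₁ {i} {j} y z w
                    ; okʸ = λ {i} {j} x z → ok₂ {i} {j} x z w ; okᶻ = λ {i} {j} x y → ok₃ {i} {j} x y w }
  slice₃ z = record { colourAt = λ x y w → c x y z w ; okˣ = λ {i} {j} y w → ok₁ {i} {j} y z w
                    ; okʸ = λ {i} {j} x w → ok₂ {i} {j} x z w ; okᶻ = λ {i} {j} x y → ok₄ {i} {j} x y z }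

  rim≥ : (f : W → ℕ) → (∀ w → 54 ≤ f w) → 270 + f 5F ≤ ∑ f
  rim≥ f le = ≤-trans (≤-reflexive (+-comm 270 (f 5F))) (+-monoʳ-≤ (f 5F)
    (+-mono-≤ (le 0F) (+-mono-≤ (le 1F) (+-mono-≤ (le 4F) (+-mono-≤ (le 2F) (+-mono-≤ (le 3F) z≤n))))))

  -- In each direction the hub position contributes its exact value, `B + hh` or `A + hh`, and only
  -- the rim is estimated by 54. When the two inequalities are added, `A` and `B` cancel.
  gaps≥277 : 277 ≤ ∑ λ w → ∑ λ z → plane z w
  gaps≥277 = *-cancelˡ-≤ 2 (+-cancelʳ-≤ (A + B) 554 (2 * N) (begin
    554 + (A + B)                               ≤⟨ +-monoˡ-≤ (A + B) (+-monoʳ-≤ 540 (+-mono-≤ hh≥7 hh≥7)) ⟩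
    540 + (hh + hh) + (A + B)                   ≡⟨ regroup A B hh ⟩
    (270 + (B + hh)) + (270 + (A + hh))         ≤⟨ +-mono-≤ by-w by-z ⟩
    (N + A) + (N + B)                           ≡⟨ regroup′ A B N ⟩
    2 * N + (A + B)                             ∎))
    where
    open ≤-Reasoning
    A B N hh : ℕ
    A  = ∑ λ w → plane 5F w
    B  = ∑ λ z → plane z 5F
    N  = ∑ λ w → ∑ λ z → plane z w
    hh = plane 5F 5F
    hh≥7 : 7 ≤ hh
    hh≥7 = layer≥ (slice₄ 5F) 5F
    by-w : 270 + (B + hh) ≤ N + A
    by-w = ≤-trans (rim≥ (λ w → ∑ (λ z → plane z w) + plane 5F w) (layers≥54 ∘ slice₄))
             (≤-reflexive (sumOver-+ order (λ w → ∑ λ z → plane z w) (plane 5F)))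
    by-z : 270 + (A + hh) ≤ N + B
    by-z = ≤-trans (rim≥ (λ z → ∑ (λ w → plane z w) + plane z 5F) (layers≥54 ∘ slice₃))
             (≤-reflexive (trans (sumOver-+ order (λ z → ∑ λ w → plane z w) (λ z → plane z 5F))
               (cong (_+ B) (sumOver-swap order order plane))))
    regroup : ∀ A B hh → 540 + (hh + hh) + (A + B) ≡ (270 + (B + hh)) + (270 + (A + hh))
    regroup = solve-∀
    regroup′ : ∀ A B N → (N + A) + (N + B) ≡ 2 * N + (A + B)
    regroup′ = solve-∀

-- Independent sets

sumFin : ∀ {n} → (Fin n → ℕ) → ℕ
sumFin {zero}  f = 0
sumFin {suc n} f = f zero + sumFin (f ∘ suc)

sumFin-splitAt : ∀ m {n} (f : Fin (m + n) → ℕ) → sumFin f ≡ sumFin (f ∘ (_↑ˡ n)) + sumFin (f ∘ (m ↑ʳ_))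
sumFin-splitAt zero    f = refl
sumFin-splitAt (suc m) f = trans (cong (f zero +_) (sumFin-splitAt m (f ∘ suc))) (sym (+-assoc (f zero) _ _))

sumFin-combine : ∀ m {n} (f : Fin (m * n) → ℕ) → sumFin f ≡ sumFin {m} (λ i → sumFin {n} (λ j → f (combine i j)))
sumFin-combine zero        f = refl
sumFin-combine (suc m) {n} f = trans (sumFin-splitAt n f)
  (cong (sumFin (f ∘ (_↑ˡ (m * n))) +_) (sumFin-combine m (f ∘ (n ↑ʳ_))))

sumFin-∑ : (f : W → ℕ) → sumFin f ≡ ∑ f
sumFin-∑ f = reorder (f 0F) (f 1F) (f 2F) (f 3F) (f 4F) (f 5F)
  where
  reorder : ∀ a b c d e h → a + (b + (c + (d + (e + (h + 0))))) ≡ h + (a + (b + (e + (c + (d + 0)))))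
  reorder = solve-∀

indicator : Bool → ℕ
indicator false = 0
indicator true  = 1

∣S∣≡sum : ∀ {n} (S : Subset n) → ∣ S ∣ ≡ sumFin (indicator ∘ lookup S)
∣S∣≡sum []           = refl
∣S∣≡sum (inside ∷ S)  = cong suc (∣S∣≡sum S)
∣S∣≡sum (outside ∷ S) = ∣S∣≡sum S

-- For variable sizes, as Agda would unfold a sum over thousands of indices.
∣S∣≡sum⁵ : ∀ a b c d e (S : Subset (a * b * c * d * e)) → ∣ S ∣ ≡
  sumFin {a} λ i → sumFin {b} λ j → sumFin {c} λ k → sumFin {d} λ l → sumFin {e} λ m →
    indicator (lookup S (combine (combine (combine (combine i j) k) l) m))
∣S∣≡sum⁵ a b c d e S = trans (∣S∣≡sum S) (trans (sumFin-combine (a * b * c * d) _)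
  (trans (sumFin-combine (a * b * c) _) (trans (sumFin-combine (a * b) _) (sumFin-combine a _))))

module _ (G H : Graph) where
  private
    module G = Graph G
    module H = Graph H
    module P = Graph (G □ H)

    -- A vertex of the product is computed from `remQuot` of its index. With variables for the two
    -- results, `remQuot-combine` can be used by matching.
    pair-~ : ∀ {p q} → Graph._~_ (G □ H) (Product.map G.vertex H.vertex p) (Product.map G.vertex H.vertex q) →
             ∀ {i j} → remQuot H.order i ≡ p → remQuot H.order j ≡ q → P.vertex i P.~ P.vertex j
    pair-~ e refl refl = e

  □-left : ∀ {i j} k → G.vertex i G.~ G.vertex j → P.vertex (combine i k) P.~ P.vertex (combine j k)
  □-left {i} {j} k e = pair-~ (inj₂ (refl , e)) (remQuot-combine i k) (remQuot-combine j k)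

  □-right : ∀ k {i j} → H.vertex i H.~ H.vertex j → P.vertex (combine k i) P.~ P.vertex (combine k j)
  □-right k {i} {j} e = pair-~ (inj₁ (refl , e)) (remQuot-combine k i) (remQuot-combine k j)

colourOf : (r g b : Bool) → Colour
colourOf true  _     _     = red
colourOf false true  _     = green
colourOf false false true  = blue
colourOf false false false = none

agree-colourOf : ∀ r g b r′ g′ b′ → ¬ (r ≡ true × r′ ≡ true) → ¬ (g ≡ true × g′ ≡ true) → ¬ (b ≡ true × b′ ≡ true) →
                 agree (colourOf r g b) (colourOf r′ g′ b′) ≡ true
agree-colourOf true  _     _     true  _     _     ¬r ¬g ¬b = ⊥-elim (¬r (refl , refl))
agree-colourOf true  _     _     false true  _     ¬r ¬g ¬b = refl
agree-colourOf true  _     _     false false true  ¬r ¬g ¬b = refl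
agree-colourOf true  _     _     false false false ¬r ¬g ¬b = refl
agree-colourOf false true  _     true  _     _     ¬r ¬g ¬b = refl
agree-colourOf false true  _     false true  _     ¬r ¬g ¬b = ⊥-elim (¬g (refl , refl))
agree-colourOf false true  _     false false true  ¬r ¬g ¬b = refl
agree-colourOf false true  _     false false false ¬r ¬g ¬b = refl
agree-colourOf false false true  true  _     _     ¬r ¬g ¬b = refl
agree-colourOf false false true  false true  _     ¬r ¬g ¬b = refl
agree-colourOf false false true  false false true  ¬r ¬g ¬b = ⊥-elim (¬b (refl , refl))
agree-colourOf false false true  false false false ¬r ¬g ¬b = refl
agree-colourOf false false false _     _     _     ¬r ¬g ¬b = refl

indicators+gap : ∀ r g b → ¬ (r ≡ true × g ≡ true) → ¬ (r ≡ true × b ≡ true) → ¬ (g ≡ true × b ≡ true) →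
  indicator r + (indicator g + (indicator b + 0)) + gap (colourOf r g b) ≡ 1
indicators+gap true  true  _     ¬rg ¬rb ¬gb = ⊥-elim (¬rg (refl , refl))
indicators+gap true  false true  ¬rg ¬rb ¬gb = ⊥-elim (¬rb (refl , refl))
indicators+gap true  false false ¬rg ¬rb ¬gb = refl
indicators+gap false true  true  ¬rg ¬rb ¬gb = ⊥-elim (¬gb (refl , refl))
indicators+gap false true  false ¬rg ¬rb ¬gb = refl
indicators+gap false false true  ¬rg ¬rb ¬gb = refl
indicators+gap false false false ¬rg ¬rb ¬gb = refl

∑₄ : (W → W → W → W → ℕ) → ℕ
∑₄ f = ∑ λ w → ∑ λ z → ∑ λ x → ∑ λ y → f x y z w

∑₄-+ : ∀ f g → ∑₄ (λ x y z w → f x y z w + g x y z w) ≡ ∑₄ f + ∑₄ g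
∑₄-+ f g =
  trans (∑-cong λ w →
    trans (∑-cong λ z →
      trans (∑-cong λ x → sumOver-+ order (λ y → f x y z w) (λ y → g x y z w))
        (sumOver-+ order (λ x → ∑ λ y → f x y z w) (λ x → ∑ λ y → g x y z w)))
      (sumOver-+ order (λ z → ∑ λ x → ∑ λ y → f x y z w) (λ z → ∑ λ x → ∑ λ y → g x y z w)))
    (sumOver-+ order (λ w → ∑ λ z → ∑ λ x → ∑ λ y → f x y z w) (λ w → ∑ λ z → ∑ λ x → ∑ λ y → g x y z w))

sumFin-∑₄ : ∀ f → (sumFin λ w → sumFin λ z → sumFin λ x → sumFin λ y → f x y z w) ≡ ∑₄ f
sumFin-∑₄ f =
  trans (sumFin-∑ λ w → sumFin λ z → sumFin λ x → sumFin λ y → f x y z w) (∑-cong λ w →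
    trans (sumFin-∑ λ z → sumFin λ x → sumFin λ y → f x y z w) (∑-cong λ z →
      trans (sumFin-∑ λ x → sumFin λ y → f x y z w) (∑-cong λ x → sumFin-∑ λ y → f x y z w)))

-- An independent set of H □ K 3 is a partial colouring of H.
module PartialColouring (H : Graph) (S : Subset (Graph.order (H □ K 3))) (ind : Graph.Independent (H □ K 3) S) where
  private
    module H = Graph H
    module P = Graph (H □ K 3)

  has : Fin H.order → Fin 3 → Bool
  has i k = lookup S (combine i k)

  excluded : ∀ i j → P.vertex i P.~ P.vertex j → ¬ (lookup S i ≡ true × lookup S j ≡ true)
  excluded i j e (p , q) = ind i j (lookup⇒[]= i S p) (lookup⇒[]= j S q) e

  colour : Fin H.order → Colour
  colour i = colourOf (has i 0F) (has i 1F) (has i 2F)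

  agrees : ∀ i j → H.vertex i H.~ H.vertex j → agree (colour i) (colour j) ≡ true
  agrees i j e = agree-colourOf (has i 0F) (has i 1F) (has i 2F) (has j 0F) (has j 1F) (has j 2F)
    (apart 0F) (apart 1F) (apart 2F)
    where
    apart : ∀ k → ¬ (has i k ≡ true × has j k ≡ true)
    apart k = excluded (combine i k) (combine j k) (□-left H (K 3) k e)

  members+gap : ∀ i → sumFin (λ k → indicator (has i k)) + gap (colour i) ≡ 1
  members+gap i = indicators+gap (has i 0F) (has i 1F) (has i 2F)
    (apart 0F 1F λ ()) (apart 0F 2F λ ()) (apart 1F 2F λ ())
    where
    apart : ∀ k l → k ≢ l → ¬ (has i k ≡ true × has i l ≡ true)
    apart k l k≢l = excluded (combine i k) (combine i l) (□-right H (K 3) i k≢l)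

module _ (A B C D : Graph) where
  private
    module A = Graph A
    module B = Graph B
    module C = Graph C
    module D = Graph D
    module P = Graph (A □ B □ C □ D)

  infix 4 _≈_
  _≈_ : Fin P.order → Fin P.order → Set
  i ≈ j = P.vertex i P.~ P.vertex j

  index : Fin A.order → Fin B.order → Fin C.order → Fin D.order → Fin P.order
  index i j k l = combine (combine (combine i j) k) l

  edge₁ : ∀ {i i′} j k l → A.vertex i A.~ A.vertex i′ → index i j k l ≈ index i′ j k l
  edge₁ j k l e = □-left (A □ B □ C) D l (□-left (A □ B) C k (□-left A B j e))

  edge₂ : ∀ i {j j′} k l → B.vertex j B.~ B.vertex j′ → index i j k l ≈ index i j′ k l
  edge₂ i k l e = □-left (A □ B □ C) D l (□-left (A □ B) C k (□-right A B i e))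

  edge₃ : ∀ i j {k k′} l → C.vertex k C.~ C.vertex k′ → index i j k l ≈ index i j k′ l
  edge₃ i j l e = □-left (A □ B □ C) D l (□-right (A □ B) C (combine i j) e)

  edge₄ : ∀ i j k {l l′} → D.vertex l D.~ D.vertex l′ → index i j k l ≈ index i j k l′
  edge₄ i j k e = □-right (A □ B □ C) D (combine (combine i j) k) e

module _ (S : Subset (Graph.order (W₅ ^□ 4 □ K 3))) (ind : Graph.Independent (W₅ ^□ 4 □ K 3) S) where

  private
    module PC = PartialColouring (W₅ ^□ 4) S ind
    ι : W → W → W → W → Fin (Graph.order (W₅ ^□ 4))
    -- The factors are taken in the order in which `∑₄` nests its sums.
    ι x y z w = index W₅ W₅ W₅ W₅ w z x y

  count : W → W → W → W → ℕ
  count x y z w = sumFin (λ k → indicator (PC.has (ι x y z w) k))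

  gapAt : W → W → W → W → ℕ
  gapAt x y z w = gap (PC.colour (ι x y z w))

  gapAt≥277 : 277 ≤ ∑₄ gapAt
  gapAt≥277 = gaps≥277 (λ x y z w → PC.colour (ι x y z w))
    (λ {i} {j} y z w e → PC.agrees (ι i y z w) (ι j y z w) (edge₃ W₅ W₅ W₅ W₅ w z {i} {j} y e))
    (λ {i} {j} x z w e → PC.agrees (ι x i z w) (ι x j z w) (edge₄ W₅ W₅ W₅ W₅ w z x {i} {j} e))
    (λ {i} {j} x y w e → PC.agrees (ι x y i w) (ι x y j w) (edge₂ W₅ W₅ W₅ W₅ w {i} {j} x y e))
    (λ {i} {j} x y z e → PC.agrees (ι x y z i) (ι x y z j) (edge₁ W₅ W₅ W₅ W₅ {i} {j} z x y e))

  members : ∣ S ∣ ≡ ∑₄ count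
  members = trans (∣S∣≡sum⁵ 6 6 6 6 3 S) (sumFin-∑₄ count)

  everything : ∑₄ count + ∑₄ gapAt ≡ ∑₄ λ _ _ _ _ → 1
  everything = trans (sym (∑₄-+ count gapAt))
    (∑-cong λ w → ∑-cong λ z → ∑-cong λ x → ∑-cong λ y → PC.members+gap (ι x y z w))

  ∣S∣≤1019 : ∣ S ∣ ≤ 1019
  -- Members and gaps together number 6⁴ = 1296 = 1019 + 277.
  ∣S∣≤1019 = +-cancelʳ-≤ 277 ∣ S ∣ 1019 (≤-trans (+-monoʳ-≤ (∣ S ∣) gapAt≥277)
    (≤-reflexive (trans (cong (_+ ∑₄ gapAt) members) everything)))

bounded : ∀ G {n} → (∀ S → Graph.Independent G S → ∣ S ∣ ≤ n) → α G ≤ n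
bounded G {n} bound = from (α-attained G)
  where
  from : ∃[ S ] (Graph.Independent G S × ∣ S ∣ ≡ α G) → α G ≤ n
  from (S , ind , eq) = subst (_≤ n) eq (bound S ind)

theorem6p7 : α (W₅ ^□ 4 □ K 3) ≤ 1019
theorem6p7 = bounded (W₅ ^□ 4 □ K 3) ∣S∣≤1019
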